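{- Let $\langle K_1,\dots,K_r\rangle$ be an Alexander $r$-tuple of simplicial complexes $K_i\subsetneq 2^V$ on a finite vertex set $V$, and let $K=K_1\ast_\Delta\cdots\ast_\Delta K_r$ be its Bier complex. Then one of the following holds (with equality of complexes understood up to isomorphism): (1) $r=2$ and $K=K_1\ast_\Delta K_2=L\ast_\Delta L^\circ$ is a Bier sphere, for some complex $L\subsetneq 2^V$; or (2) $r\ge 3$ and $K=\Delta_{n,r}^{m_1,\dots,m_r;\mathbf{1}}$ is an optimal chessboard complex, where $n=m_1+\cdots+m_r+r-1$; or (3) $r\ge3$ and $K=\Delta\ast[r]^{\ast k}$, where $\Delta=\Delta_{n,r}^{m_1,\dots,m_r;\mathbf{1}}$ is an optimal chessboard complex (so $n=m_1+\cdots+m_r+r-1$) and $[r]^{\ast k}=[r]\ast\cdots\ast[r]$ is the join of $k\ge1$ copies of the $0$-dimensional complex $[r]$.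
   Context: $[n]=\{1,\dots,n\}$. A simplicial complex on a finite vertex set $V$ is a subset $K\subseteq 2^V$ with $\emptyset\in K$ that is closed under taking subsets. All complexes $K_i$ in a tuple are assumed proper: $K_i\subsetneq 2^V$. An $r$-tuple $\langle K_1,\dots,K_r\rangle$ of complexes on $V$ is collective $r$-unavoidable if for each ordered collection $(A_1,\dots,A_r)$ of pairwise disjoint subsets of $V$ there exists $i$ with $A_i\in K_i$. It is an Alexander $r$-tuple if it is collective $r$-unavoidable and, for all $A_1\in K_1,\dots,A_r\in K_r$, the set $V\setminus\bigcup_{i=1}^r A_i$ has at least $r-1$ elements. The deleted join $K_1\ast_\Delta\cdots\ast_\Delta K_r$ is the simplicial complex (with vertices in $V\times[r]$) whose simplices are $A_1\uplus\cdots\uplus A_r$ with $A_i\in K_i$ and the $A_i$ pairwise disjoint as subsets of $V$. The Bier complex of an Alexander $r$-tuple is its deleted join. The Alexander dual of $L\subsetneq 2^V$ is $L^\circ=\{F\subseteq V\mid V\setminus F\notin L\}$, and the Bier sphere of $L$ is $Bier(L)=L\ast_\Delta L^\circ$. For non-negative integers $m_1,\dots,m_r$, the multiple chessboard complex $\Delta_{n,r}^{m_1,\dots,m_r;\mathbf{1}}$ is the complex on the vertex set $[n]\times[r]$ whose simplices are the sets $S$ with $|S\cap([n]\times\{i\})|\le m_i$ for $i=1,\dots,r$ and $|S\cap(\{j\}\times[r])|\le1$ for $j=1,\dots,n$. It is called optimal if $n=m_1+\cdots+m_r+r-1$. The $0$-dimensional complex $[r]$ consists of $r$ isolated vertices,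 and $\ast$ is the join of complexes (on disjoint vertex sets). -}

module Defs where

open import Algebra.Properties.CommutativeMonoid.Sum using (sum)
open import Data.Fin using (Fin; combine; _↑ˡ_; _↑ʳ_)
open import Data.Fin.Permutation using (Permutation; _⟨$⟩ˡ_)
open import Data.Fin.Properties using (all?; _≟_)
open import Data.Fin.Subset using (Subset; ⊥; _∈_; _⊆_; _∩_; ∁; ⋃; ∣_∣; Empty)
open import Data.Fin.Subset.Properties
  using (∉⊥; ∣⊥∣≡0; p⊆q⇒∣p∣≤∣q∣; p⊆q⇒∁p⊇∁q; x∉p⇒x∈∁p; nonempty?; x∈p∩q⁺; x∈p∩q⁻)
import Data.List as List
open import Data.Nat using (ℕ; zero; suc; _+_; _*_; _∸_; _≤_; _≤?_; z≤n)
open import Data.Nat.Properties using (≤-trans; ≤-reflexive; +-0-commutativeMonoid)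
open import Data.Product using (∃-syntax; _×_; _,_; proj₁; proj₂)
open import Data.Unit using (tt) renaming (⊤ to Unit)
open import Data.Vec using (lookup; tabulate)
open import Data.Vec.Functional using (_∷_; [])
open import Data.Vec.Properties using (lookup∘tabulate; lookup⇒[]=; []=⇒lookup)
open import Function using (_⇔_; _∘_)
open import Level using (0ℓ)
open import Relation.Binary.PropositionalEquality using (_≡_; _≢_; sym; trans)
open import Relation.Nullary using (¬_; yes; contradiction)
open import Relation.Nullary.Decidable using (¬?; _×-dec_; _→-dec_)
open import Relation.Unary using (Pred; Decidable; U; _⊂_)

preimage : ∀ {m n} → (Fin m → Fin n) → Subset n → Subset m
preimage f S = tabulate (lookup S ∘ f)

∈-preimage⁺ : ∀ {m n} (f : Fin m → Fin n) {S x} → f x ∈ S → x ∈ preimage f S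
∈-preimage⁺ f {S} {x} fx∈S =
  lookup⇒[]= x _ (trans (lookup∘tabulate (lookup S ∘ f) x) ([]=⇒lookup fx∈S))

∈-preimage⁻ : ∀ {m n} (f : Fin m → Fin n) {S x} → x ∈ preimage f S → f x ∈ S
∈-preimage⁻ f {S} {x} x∈ =
  lookup⇒[]= (f x) S (trans (sym (lookup∘tabulate (lookup S ∘ f) x)) ([]=⇒lookup x∈))

preimage-mono : ∀ {m n} (f : Fin m → Fin n) {S T} → S ⊆ T → preimage f S ⊆ preimage f T
preimage-mono f S⊆T = ∈-preimage⁺ f ∘ S⊆T ∘ ∈-preimage⁻ f

preimage-⊥ : ∀ {m n} (f : Fin m → Fin n) {T} → preimage f ⊥ ⊆ T
preimage-⊥ f x∈ = contradiction (∈-preimage⁻ f x∈) ∉⊥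

∣∣-mono-≤ : ∀ {n k} (A B : Subset n) → ∣ B ∣ ≤ k → A ⊆ B → ∣ A ∣ ≤ k
∣∣-mono-≤ _ _ ∣B∣≤k A⊆B = ≤-trans (p⊆q⇒∣p∣≤∣q∣ A⊆B) ∣B∣≤k

∣⊥∣≤ : ∀ n {k} → ∣ ⊥ {n} ∣ ≤ k
∣⊥∣≤ n = ≤-trans (≤-reflexive (∣⊥∣≡0 n)) z≤n

∣preimage∣-mono : ∀ {m n k} (f : Fin m → Fin n) {S T} →
                  ∣ preimage f T ∣ ≤ k → S ⊆ T → ∣ preimage f S ∣ ≤ k
∣preimage∣-mono f ∣T∣≤k S⊆T = ∣∣-mono-≤ _ _ ∣T∣≤k (preimage-mono f S⊆T)

∣preimage-⊥∣ : ∀ {m n k} (f : Fin m → Fin n) → ∣ preimage f ⊥ ∣ ≤ k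
∣preimage-⊥∣ {m} f = ∣∣-mono-≤ _ ⊥ (∣⊥∣≤ m) (preimage-⊥ f)

-- The vertex set is Fin v.  Not every element of Fin v need be a face, so
-- the vertex set is part of the data.  Classically every family of subsets of
-- a finite set has decidable membership; constructively this must be recorded.
record Complex (v : ℕ) : Set₁ where
  field
    Face     : Pred (Subset v) 0ℓ
    Face?    : Decidable Face
    ⊥-face   : Face ⊥
    ⊆-closed : ∀ {A B} → Face B → A ⊆ B → Face A

open Complex public

Proper : ∀ {v} → Complex v → Set
Proper K = Face K ⊂ U

-- The identification of the vertex sets is a bijection of the whole ground
-- sets, including elements that are not themselves faces.
record _≅_ {m n : ℕ} (K : Complex m) (L : Complex n) : Set where
  field
    vertices : Permutation m n
    -- preimage (vertices ⟨$⟩ˡ_) S is the image of S under vertices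
    faces    : ∀ S → Face K S ⇔ Face L (preimage (vertices ⟨$⟩ˡ_) S)

infix 4 _≅_

PairwiseDisjoint : ∀ {v r} → (Fin r → Subset v) → Set
PairwiseDisjoint A = ∀ i j → i ≢ j → Empty (A i ∩ A j)

CollectiveUnavoidable : ∀ {v r} → (Fin r → Complex v) → Set
CollectiveUnavoidable K =
  ∀ A → PairwiseDisjoint A → ∃[ i ] Face (K i) (A i)

record IsAlexander {v r : ℕ} (K : Fin r → Complex v) : Set where
  field
    proper      : ∀ i → Proper (K i)
    unavoidable : CollectiveUnavoidable K
    large-gap   : ∀ A → (∀ i → Face (K i) (A i)) → r ∸ 1 ≤ ∣ ∁ (⋃ (List.tabulate A)) ∣

-- The product Fin n × Fin r is encoded as Fin (n * r) through combine.
-- column i S = { x | (x , i) ∈ S }  and  row x S = { i | (x , i) ∈ S }.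

column : ∀ {n r} → Fin r → Subset (n * r) → Subset n
column i = preimage (λ x → combine x i)

row : ∀ {n r} → Fin n → Subset (n * r) → Subset r
row x = preimage (combine x)

-- A subset S of V × [r] is A₁ ⊎ … ⊎ Aᵣ for exactly one tuple of subsets of V,
-- namely Aᵢ = column i S.
deletedJoin : ∀ {v r} → (Fin r → Complex v) → Complex (v * r)
deletedJoin {v} {r} K = record
  { Face     = λ S → (∀ i → Face (K i) (column i S)) × PairwiseDisjoint (λ i → column {v} i S)
  ; Face?    = λ S → all? (λ i → Face? (K i) (column i S))
                 ×-dec all? (λ i → all? λ j → ¬? (i ≟ j) →-dec
                         ¬? (nonempty? (column {v} i S ∩ column j S)))
  ; ⊥-face   = (λ i → ⊆-closed (K i) (⊥-face (K i)) (preimage-⊥ (λ x → combine x i)))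
             , λ i j _ (x , x∈) → ∉⊥ (∈-preimage⁻ (λ y → combine y i) (proj₁ (x∈p∩q⁻ _ _ x∈)))
  ; ⊆-closed = λ (f , d) A⊆B →
                 (λ i → ⊆-closed (K i) (f i) (preimage-mono (λ x → combine x i) A⊆B))
               , λ i j i≢j (x , x∈) → let (x∈i , x∈j) = x∈p∩q⁻ _ _ x∈ in
                   d i j i≢j (x , x∈p∩q⁺ ( preimage-mono (λ y → combine y i) A⊆B x∈i
                                         , preimage-mono (λ y → combine y j) A⊆B x∈j))
  }

-- Properness of L is what makes the empty set a face of the dual.
alexanderDual : ∀ {v} (L : Complex v) → Proper L → Complex v
alexanderDual L L-proper = record
  { Face     = λ F → ¬ Face L (∁ F)
  ; Face?    = λ F → ¬? (Face? L (∁ F))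
  ; ⊥-face   = λ ∁⊥∈L → proj₂ L-proper
                 (λ _ → ⊆-closed L ∁⊥∈L (λ _ → x∉p⇒x∈∁p ∉⊥))
  ; ⊆-closed = λ ∁B∉L A⊆B ∁A∈L → ∁B∉L (⊆-closed L ∁A∈L (p⊆q⇒∁p⊇∁q A⊆B))
  }

bierSphere : ∀ {v} (L : Complex v) → Proper L → Complex (v * 2)
bierSphere L L-proper = deletedJoin (L ∷ alexanderDual L L-proper ∷ [])

chessboard : (n r : ℕ) → (Fin r → ℕ) → Complex (n * r)
chessboard n r m = record
  { Face     = λ S → (∀ i → ∣ column {n} i S ∣ ≤ m i) × (∀ x → ∣ row {n} x S ∣ ≤ 1)
  ; Face?    = λ S → all? (λ i → ∣ column {n} i S ∣ ≤? m i)
                 ×-dec all? (λ x → ∣ row {n} x S ∣ ≤? 1)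
  ; ⊥-face   = (λ i → ∣preimage-⊥∣ (λ (x : Fin n) → combine x i))
             , (λ x → ∣preimage-⊥∣ (combine {n} {r} x))
  ; ⊆-closed = λ (c , d) A⊆B → (λ i → ∣preimage∣-mono (λ (x : Fin n) → combine x i) (c i) A⊆B)
                             , (λ x → ∣preimage∣-mono (combine {n} {r} x) (d x) A⊆B)
  }

Optimal : (n r : ℕ) → (Fin r → ℕ) → Set
Optimal n r m = n ≡ sum +-0-commutativeMonoid m + r ∸ 1

points : (r : ℕ) → Complex r
points r = record
  { Face     = λ S → ∣ S ∣ ≤ 1
  ; Face?    = λ S → ∣ S ∣ ≤? 1
  ; ⊥-face   = ∣⊥∣≤ r
  ; ⊆-closed = ∣∣-mono-≤ _ _
  }

-- The disjoint union of Fin m and Fin n is Fin (m + n).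
_*ʲ_ : ∀ {m n} → Complex m → Complex n → Complex (m + n)
_*ʲ_ {m} {n} K L = record
  { Face     = λ S → Face K (preimage (_↑ˡ n) S) × Face L (preimage (m ↑ʳ_) S)
  ; Face?    = λ S → Face? K (preimage (_↑ˡ n) S) ×-dec Face? L (preimage (m ↑ʳ_) S)
  ; ⊥-face   = ⊆-closed K (⊥-face K) (preimage-⊥ (_↑ˡ n))
             , ⊆-closed L (⊥-face L) (preimage-⊥ (m ↑ʳ_))
  ; ⊆-closed = λ (k , l) A⊆B → ⊆-closed K k (preimage-mono (_↑ˡ n) A⊆B)
                             , ⊆-closed L l (preimage-mono (m ↑ʳ_) A⊆B)
  }

infixr 7 _*ʲ_

-- The complex { ∅ } on no vertices, the unit of the join.
emptyJoin : Complex 0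
emptyJoin = record
  { Face     = λ _ → Unit
  ; Face?    = λ _ → yes tt
  ; ⊥-face   = tt
  ; ⊆-closed = λ _ _ → tt
  }

joinPower : ∀ {v} → Complex v → (k : ℕ) → Complex (k * v)
joinPower K zero    = emptyJoin
joinPower K (suc k) = K *ʲ joinPower K k

{-# OPTIONS --safe #-}
module Submission where

-- For r ≥ 3, label the points of V by zero (in no Aᵢ) or by suc i (in Aᵢ), all Aᵢ
-- faces.  The two Alexander conditions make every maximal labelling leave exactly
-- r ∸ 1 points unlabelled.  Removing a point a from Aᵢ then leaves r free points, and
-- unavoidability forces a dichotomy: either a can be put into every Aⱼ (a is movable),
-- or a can be replaced in Aᵢ by any unlabelled point (a is fixed).  For r ≥ 3 there is
-- always a third label, untouched by a given move, which witnesses that the type of a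
-- point does not change along these moves.  Moving from one facet to all others gives
-- Face Kᵢ A exactly when A has at most mᵢ fixed points: the fixed points span the optimal
-- chessboard complex, and each movable point contributes a join factor [r].
-- For r = 2 the two conditions say that K₂ is the Alexander dual of K₁.

open import Defs
import Algebra.Properties.CommutativeMonoid.Sum as Sum
open import Data.Bool using (true; false; if_then_else_)
import Data.Empty as Empty
open import Data.Fin using (Fin; zero; suc; combine; splitAt; _↑ˡ_; _↑ʳ_)
open import Data.Fin.Permutation using (_⟨$⟩ˡ_)
open import Data.Fin.Permutation.Components using (transpose; transpose-inverse)
open import Data.Fin.Properties
  using (_≟_; suc-injective; any?; all?; ¬∀⟶∃¬; splitAt-↑ˡ; splitAt-↑ʳ; splitAt⁻¹-↑ˡ;
         remQuot-combine; +↔⊎; *↔×)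
open import Data.Fin.Subset
  using (Subset; inside; outside; ⊤; ⁅_⁆; _∈_; _∉_; _⊆_; _∪_; _∩_; _-_; ∁; ⋃; ∣_∣)
open import Data.Fin.Subset.Properties
import Data.List as List
open import Data.Nat using (ℕ; zero; suc; _+_; _*_; _∸_; _≤_; _<_; z≤n; s≤s)
open import Data.Nat.Induction using (Acc; acc; <-wellFounded)
import Data.Nat.Properties as ℕ
open import Data.Nat.Properties using (≤-trans; ≤-antisym; <-irrefl; <-≤-trans; +-0-commutativeMonoid)
open import Data.Product using (∃-syntax; Σ-syntax; _×_; _,_; proj₁; proj₂)
open import Data.Product.Function.NonDependent.Propositional using (_×-↔_)
open import Data.Sum using (_⊎_; inj₁; inj₂; [_,_]′; map₁; map₂)
open import Data.Sum.Function.Propositional using (_⊎-↔_)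
open import Data.Sum.Properties using (inj₁-injective)
open import Data.Unit using (tt)
open import Data.Vec using (tabulate; lookup; []; _∷_; here; there)
import Data.Vec.Functional as Vector
open import Data.Vec.Functional using (updateAt)
open import Data.Vec.Functional.Properties
  using (updateAt-updates; updateAt-minimal; updateAt-updateAt; updateAt-id-local)
open import Data.Vec.Properties
  using (tabulate-cong; lookup∘tabulate; tabulate∘lookup; lookup⇒[]=; []=⇒lookup)
open import Function using (const; _∘_; _↔_; _⇔_; mk⇔; mk↔ₛ′; Inverse; Equivalence)
open import Function.Definitions using (Injective)
open import Function.Properties.Inverse using (↔-refl; ↔-sym; ↔-trans)
open import Function.Related.TypeIsomorphisms using (×-distribʳ-⊎)
open import Level using (0ℓ)
open import Relation.Binary.PropositionalEquality
open import Relation.Nullary using (¬_; Dec; yes; no; does; contradiction)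
open import Relation.Nullary.Decidable using (map′; dec-true; dec-false; _×-dec_; ¬?)
open import Relation.Unary using (Pred; Decidable)

private
  variable
    k l m n r t v : ℕ

-- Subsets, cardinalities and injections

toSubset : {P : Pred (Fin n) 0ℓ} → Decidable P → Subset n
toSubset P? = tabulate (does ∘ P?)

∈-toSubset⁺ : {P : Pred (Fin n) 0ℓ} (P? : Decidable P) {x : Fin n} → P x → x ∈ toSubset P?
∈-toSubset⁺ P? {x} px = lookup⇒[]= x _ (trans (lookup∘tabulate (does ∘ P?) x) (dec-true (P? x) px))

∈-toSubset⁻ : {P : Pred (Fin n) 0ℓ} (P? : Decidable P) {x : Fin n} → x ∈ toSubset P? → P x
∈-toSubset⁻ P? {x} x∈ with P? x | trans (sym (lookup∘tabulate (does ∘ P?) x)) ([]=⇒lookup x∈)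
... | yes px | _ = px

p⊆⋃ : (A : Fin m → Subset n) (i : Fin m) → A i ⊆ ⋃ (List.tabulate A)
p⊆⋃ A zero    x∈ = p⊆p∪q _ x∈
p⊆⋃ A (suc i) x∈ = q⊆p∪q (A zero) _ (p⊆⋃ (A ∘ suc) i x∈)

-- Induction on `p`, deleting the image of each member from `q`. The map is required on members
-- only, so an inverse that exists just there can be used.
injective⇒∣p∣≤∣q∣ : (p : Subset m) (q : Subset n) (f : ∀ {x} → x ∈ p → Fin n) →
                    (∀ {x y} (x∈ : x ∈ p) (y∈ : y ∈ p) → f x∈ ≡ f y∈ → x ≡ y) →
                    (∀ {x} (x∈ : x ∈ p) → f x∈ ∈ q) → ∣ p ∣ ≤ ∣ q ∣
injective⇒∣p∣≤∣q∣ []            q f inj f∈q = z≤n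
injective⇒∣p∣≤∣q∣ (outside ∷ p) q f inj f∈q =
  injective⇒∣p∣≤∣q∣ p q (f ∘ there)
    (λ x∈ y∈ eq → suc-injective (inj (there x∈) (there y∈) eq)) (f∈q ∘ there)
injective⇒∣p∣≤∣q∣ (inside ∷ p)  q f inj f∈q =
  ≤-trans (s≤s (injective⇒∣p∣≤∣q∣ p (q - f here) (f ∘ there)
    (λ x∈ y∈ eq → suc-injective (inj (there x∈) (there y∈) eq))
    λ x∈ → x∈p∧x≢y⇒x∈p-y (f∈q (there x∈)) λ eq → contradiction (inj (there x∈) here eq) λ ()))
  (x∈p⇒∣p-x∣<∣p∣ (f∈q here))

∃∈q∉p⊎q⊆p : (p q : Subset n) → (∃[ y ] y ∈ q × y ∉ p) ⊎ q ⊆ p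
∃∈q∉p⊎q⊆p p q with any? (λ y → (y ∈? q) ×-dec ¬? (y ∈? p))
... | yes found = inj₁ found
... | no none   = inj₂ q⊆p
  where
  q⊆p : q ⊆ p
  q⊆p {y} y∈q with y ∈? p
  ... | yes y∈p = y∈p
  ... | no y∉p  = contradiction (y , y∈q , y∉p) none

∣p∣<∣q∣⇒∃∈q∉p : {p q : Subset n} → ∣ p ∣ < ∣ q ∣ → ∃[ y ] y ∈ q × y ∉ p
∣p∣<∣q∣⇒∃∈q∉p {p = p} {q} ∣p∣<∣q∣ with ∃∈q∉p⊎q⊆p p q
... | inj₁ found = found
... | inj₂ q⊆p   = contradiction (<-≤-trans ∣p∣<∣q∣ (p⊆q⇒∣p∣≤∣q∣ q⊆p)) (<-irrefl refl)

∣p∣≤∣q∣∧p⊈q⇒∃∈q∉p : {p q : Subset n} {x : Fin n} → ∣ p ∣ ≤ ∣ q ∣ → x ∈ p → x ∉ q →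
                    ∃[ y ] y ∈ q × y ∉ p
∣p∣≤∣q∣∧p⊈q⇒∃∈q∉p {p = p} {q} {x} ∣p∣≤∣q∣ x∈p x∉q with ∃∈q∉p⊎q⊆p p q
... | inj₁ found = found
... | inj₂ q⊆p   = contradiction (<-≤-trans (p⊂q⇒∣p∣<∣q∣ (q⊆p , x , x∈p , x∉q)) ∣p∣≤∣q∣) (<-irrefl refl)

enumerate : (n : ℕ) (p : Subset v) → n ≤ ∣ p ∣ →
            Σ[ ρ ∈ (Fin n → Fin v) ] Injective _≡_ _≡_ ρ × (∀ k → ρ k ∈ p)
enumerate zero    p             n≤∣p∣ = (λ ()) , (λ { {()} }) , λ ()
enumerate (suc n) (outside ∷ p) n≤∣p∣ =
  let ρ , inj , ρ∈p = enumerate (suc n) p n≤∣p∣ in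
  suc ∘ ρ , inj ∘ suc-injective , there ∘ ρ∈p
enumerate {suc v} (suc n) (inside ∷ p) (s≤s n≤∣p∣) = ρ′ , inj′ , ρ′∈
  where
  rest = enumerate n p n≤∣p∣
  ρ′ : Fin (suc n) → Fin (suc v)
  ρ′ zero    = zero
  ρ′ (suc k) = suc (proj₁ rest k)
  inj′ : Injective _≡_ _≡_ ρ′
  inj′ {zero}  {zero}  eq = refl
  inj′ {suc k} {suc l} eq = cong suc (proj₁ (proj₂ rest) (suc-injective eq))
  ρ′∈ : ∀ k → ρ′ k ∈ inside ∷ p
  ρ′∈ zero    = here
  ρ′∈ (suc k) = there (proj₂ (proj₂ rest) k)

-- Transpositions and injections with prescribed values

transpose-ˡ : (i j : Fin n) → transpose i j i ≡ j
transpose-ˡ i j rewrite dec-true (i ≟ i) refl = refl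

transpose-ʳ : (i j : Fin n) → transpose i j j ≡ i
transpose-ʳ i j with j ≟ i
... | yes j≡i = j≡i
... | no _ rewrite dec-true (j ≟ j) refl = refl

transpose-≢ : {i j k : Fin n} → k ≢ i → k ≢ j → transpose i j k ≡ k
transpose-≢ {i = i} {j} {k} k≢i k≢j
  rewrite dec-false (k ≟ i) k≢i | dec-false (k ≟ j) k≢j = refl

transpose-injective : (i j : Fin n) → Injective _≡_ _≡_ (transpose i j)
transpose-injective i j {x} {y} eq =
  trans (sym (transpose-inverse j i)) (trans (cong (transpose j i) eq) (transpose-inverse j i))

transpose-preserves : (P : Pred (Fin n) 0ℓ) {i j k : Fin n} → P i → P j → P k → P (transpose i j k)
transpose-preserves P {i} {j} {k} pi pj pk with k ≟ i
... | yes _ = pj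
... | no _ with k ≟ j
...   | yes _ = pi
...   | no _  = pk

-- Following `ρ` by the transposition of `x` and `ρ i` keeps it injective even when `x` is already a
-- value; only the values `x` and `ρ i` are affected.
prescribe : (P : Pred (Fin v) 0ℓ) {ρ : Fin n → Fin v} → Injective _≡_ _≡_ ρ → (∀ k → P (ρ k)) →
            (i : Fin n) {x : Fin v} → P x →
            Σ[ ρ′ ∈ (Fin n → Fin v) ] Injective _≡_ _≡_ ρ′ × (∀ k → P (ρ′ k)) × ρ′ i ≡ x ×
              (∀ k → ρ k ≢ x → ρ k ≢ ρ i → ρ′ k ≡ ρ k)
prescribe P {ρ} inj Pρ i {x} px =
    transpose x (ρ i) ∘ ρ
  , inj ∘ transpose-injective x (ρ i)
  , (λ k → transpose-preserves P px (Pρ i) (Pρ k))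
  , transpose-ʳ x (ρ i)
  , λ k → transpose-≢

-- The second prescription, at `j`, leaves the value `x` at `i` alone, since it is neither `y` nor
-- the value at `j`.
prescribe₂ : (P : Pred (Fin v) 0ℓ) {ρ : Fin n → Fin v} → Injective _≡_ _≡_ ρ → (∀ k → P (ρ k)) →
             {i j : Fin n} {x y : Fin v} → i ≢ j → x ≢ y → P x → P y →
             Σ[ ρ′ ∈ (Fin n → Fin v) ] Injective _≡_ _≡_ ρ′ × (∀ k → P (ρ′ k)) × ρ′ i ≡ x × ρ′ j ≡ y
prescribe₂ P inj Pρ {i} {j} i≢j x≢y px py =
  let ρ′ , inj′ , Pρ′ , ρ′i≡x , _    = prescribe P inj Pρ i px
      ρ″ , inj″ , Pρ″ , ρ″j≡y , same = prescribe P inj′ Pρ′ j py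
      ρ′i≢y = λ eq → x≢y (trans (sym ρ′i≡x) eq)
  in ρ″ , inj″ , Pρ″ , trans (same i ρ′i≢y (i≢j ∘ inj′)) ρ′i≡x , ρ″j≡y

-- Fibers and point updates of labellings

fiber : (Fin v → Fin t) → Fin t → Subset v
fiber f l = toSubset (λ x → f x ≟ l)

∈-fiber⁺ : (f : Fin v → Fin t) {l : Fin t} {x : Fin v} → f x ≡ l → x ∈ fiber f l
∈-fiber⁺ f {l} = ∈-toSubset⁺ (λ x → f x ≟ l)

∈-fiber⁻ : (f : Fin v → Fin t) {l : Fin t} {x : Fin v} → x ∈ fiber f l → f x ≡ l
∈-fiber⁻ f {l} = ∈-toSubset⁻ (λ x → f x ≟ l)

fiber-cong : {f g : Fin v → Fin t} → f ≗ g → (l : Fin t) → fiber f l ≡ fiber g l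
fiber-cong f≗g l = tabulate-cong λ x → cong (λ k → does (k ≟ l)) (f≗g x)

infixl 9 _[_↦_]

_[_↦_] : {B : Set} → (Fin v → B) → Fin v → B → Fin v → B
f [ a ↦ l ] = updateAt f a (const l)

update-≡ : {B : Set} (f : Fin v → B) (a : Fin v) {l : B} → (f [ a ↦ l ]) a ≡ l
update-≡ f a = updateAt-updates a f

update-≢ : {B : Set} (f : Fin v → B) {a y : Fin v} {l : B} → y ≢ a → (f [ a ↦ l ]) y ≡ f y
update-≢ f {a} {y} y≢a = updateAt-minimal y a f y≢a

update-cases : {B : Set} (f : Fin v → B) (a : Fin v) (l : B) (y : Fin v) →
               (y ≡ a × (f [ a ↦ l ]) y ≡ l) ⊎ (y ≢ a × (f [ a ↦ l ]) y ≡ f y)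
update-cases f a l y with y ≟ a
... | yes refl = inj₁ (refl , update-≡ f a)
... | no y≢a   = inj₂ (y≢a , update-≢ f y≢a)

∣fiber∣-update : (f : Fin v → Fin (suc t)) (a : Fin v) (k : Fin t) → f a ≡ zero →
                 suc ∣ fiber (f [ a ↦ suc k ]) zero ∣ ≡ ∣ fiber f zero ∣
∣fiber∣-update f zero    k fa≡0 with f zero | fa≡0
... | zero | refl = refl
∣fiber∣-update f (suc a) k fa≡0 with f zero
... | zero  = cong suc (∣fiber∣-update (f ∘ suc) a k fa≡0)
... | suc _ = ∣fiber∣-update (f ∘ suc) a k fa≡0

update-update : {B : Set} (f : Fin v → B) (a : Fin v) {k l : B} → f [ a ↦ k ] [ a ↦ l ] ≗ f [ a ↦ l ]
update-update f a = updateAt-updateAt a f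

update-self : {B : Set} (f : Fin v → B) (a : Fin v) {l : B} → f a ≡ l → f [ a ↦ l ] ≗ f
update-self f a fa≡l = updateAt-id-local a f (sym fa≡l)

update-cong : {B : Set} {f g : Fin v → B} (a : Fin v) {l : B} → f ≗ g → f [ a ↦ l ] ≗ g [ a ↦ l ]
update-cong {f = f} {g} a {l} f≗g y with update-cases f a l y
... | inj₁ (refl , eq)  = trans eq (sym (update-≡ g a))
... | inj₂ (y≢a , eq) = trans eq (trans (f≗g y) (sym (update-≢ g y≢a)))

∘-transpose-trivial : {B : Set} (f : Fin v → B) {a x : Fin v} → f a ≡ f x → f ∘ transpose a x ≗ f
∘-transpose-trivial f {a} {x} fa≡fx y with y ≟ a
... | yes refl = sym fa≡fx
... | no _ with y ≟ x
...   | yes refl = fa≡fx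
...   | no _     = refl

∘-transpose-update : {B : Set} (f : Fin v → B) {a x : Fin v} → a ≢ x →
                     f ∘ transpose a x ≗ f [ a ↦ f x ] [ x ↦ f a ]
∘-transpose-update f {a} {x} a≢x y with y ≟ a
... | yes refl = sym (trans (update-≢ (f [ a ↦ f x ]) a≢x) (update-≡ f a))
... | no y≢a with y ≟ x
...   | yes refl = sym (update-≡ (f [ a ↦ f x ]) x)
...   | no y≢x   = sym (trans (update-≢ (f [ a ↦ f x ]) y≢x) (update-≢ f y≢a))

-- Having at least three members enters here: a label avoiding two given ones lets one point be
-- relabelled independently of another move. With `p` equal to `q` it merely supplies a different
-- label.
third : (p q : Fin (3 + n)) → ∃[ x ] x ≢ p × x ≢ q
third zero          zero          = suc zero       , (λ ()) , λ ()
third zero          (suc zero)    = suc (suc zero) , (λ ()) , λ ()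
third zero          (suc (suc _)) = suc zero       , (λ ()) , λ ()
third (suc zero)    zero          = suc (suc zero) , (λ ()) , λ ()
third (suc (suc _)) zero          = suc zero       , (λ ()) , λ ()
third (suc _)       (suc _)       = zero           , (λ ()) , λ ()

-- Alexander tuples with at least three members

module Exchange {v s : ℕ} (K : Fin (3 + s) → Complex v) (alexander : IsAlexander K) where

  open IsAlexander alexander

  -- The label zero marks the points outside all Aᵢ, the label suc i those of Aᵢ.
  Labelling : Set
  Labelling = Fin v → Fin (4 + s)

  zeros : Labelling → ℕ
  zeros f = ∣ fiber f zero ∣

  -- The classes of a labelling are disjoint by construction, so a good labelling is a simplex of
  -- the deleted join.
  record Good (f : Labelling) : Set where
    constructor mkGood
    field face : ∀ i → Face (K i) (fiber f (suc i))

  open Good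

  Good? : Decidable Good
  Good? f = map′ mkGood face (all? λ i → Face? (K i) (fiber f (suc i)))

  -- The face conditions concern one label at a time, so each class may be bounded by a different
  -- good labelling.
  good-cover : {g : Labelling} →
               (∀ k → ∃[ f ] Good f × (∀ {y} → g y ≡ suc k → f y ≡ suc k)) → Good g
  good-cover {g} cover = mkGood λ k →
    let f , good , g⊆f = cover k in
    ⊆-closed (K k) (face good k) (∈-fiber⁺ f ∘ g⊆f ∘ ∈-fiber⁻ g)

  good-mono : {f g : Labelling} → (∀ {y k} → g y ≡ suc k → f y ≡ suc k) → Good f → Good g
  good-mono {f} g⊆f good = good-cover λ _ → f , good , g⊆f

  good-resp : {f g : Labelling} → f ≗ g → Good f → Good g
  good-resp f≗g = good-mono λ {y} → trans (f≗g y)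

  -- A point outside the union of all classes carries `zero`, so `large-gap` bounds the unlabelled
  -- points from below.
  gap : {f : Labelling} → Good f → 2 + s ≤ zeros f
  gap {f} good = ≤-trans (large-gap (fiber f ∘ suc) (face good)) (p⊆q⇒∣p∣≤∣q∣ outside⊆)
    where
    outside⊆ : ∁ (⋃ (List.tabulate (fiber f ∘ suc))) ⊆ fiber f zero
    outside⊆ {x} x∈ with f x in fx
    ... | zero  = ∈-fiber⁺ f fx
    ... | suc k = contradiction (p⊆⋃ (fiber f ∘ suc) k (∈-fiber⁺ f fx)) (x∈∁p⇒x∉p x∈)

  -- The class of `k′` is covered by the second labelling, every other class by the first. As
  -- `k ≢ k′`, inserting `z` adds nothing to the class of `k′`.
  merge : {f : Labelling} {z z′ : Fin v} {k k′ : Fin (3 + s)} → k ≢ k′ →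
          Good (f [ z ↦ suc k ]) → Good (f [ z′ ↦ suc k′ ]) → Good (f [ z ↦ suc k ] [ z′ ↦ suc k′ ])
  merge {f} {z} {z′} {k} {k′} k≢k′ good good′ = good-cover cover
    where
    cover : ∀ l → ∃[ g ] Good g × (∀ {y} → (f [ z ↦ suc k ] [ z′ ↦ suc k′ ]) y ≡ suc l → g y ≡ suc l)
    cover l with l ≟ k′
    ... | yes refl = f [ z′ ↦ suc k′ ] , good′ , sub
      where
      sub : ∀ {y} → (f [ z ↦ suc k ] [ z′ ↦ suc k′ ]) y ≡ suc l → (f [ z′ ↦ suc k′ ]) y ≡ suc l
      sub {y} eq with update-cases (f [ z ↦ suc k ]) z′ (suc k′) y
      ... | inj₁ (refl , _) = update-≡ f z′
      ... | inj₂ (y≢z′ , eq′) with update-cases f z (suc k) y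
      ...   | inj₁ (_ , eq″) = contradiction (suc-injective (trans (sym eq″) (trans (sym eq′) eq))) k≢k′
      ...   | inj₂ (_ , eq″) = trans (update-≢ f y≢z′) (trans (sym eq″) (trans (sym eq′) eq))
    ... | no l≢k′ = f [ z ↦ suc k ] , good , sub
      where
      sub : ∀ {y} → (f [ z ↦ suc k ] [ z′ ↦ suc k′ ]) y ≡ suc l → (f [ z ↦ suc k ]) y ≡ suc l
      sub {y} eq with update-cases (f [ z ↦ suc k ]) z′ (suc k′) y
      ... | inj₁ (_ , eq′) = contradiction (suc-injective (trans (sym eq) eq′)) l≢k′
      ... | inj₂ (_ , eq′) = trans (sym eq′) eq

  -- Relabelling `z` can only shrink the classes other than `k`, even if `z` was labelled before.
  good-extend : {g : Labelling} {z : Fin v} {k : Fin (3 + s)} → Good g →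
                Face (K k) (fiber g (suc k) ∪ ⁅ z ⁆) → Good (g [ z ↦ suc k ])
  good-extend {g} {z} {k} good gz-face = mkGood λ l → faces l (l ≟ k)
    where
    faces : ∀ l → Dec (l ≡ k) → Face (K l) (fiber (g [ z ↦ suc k ]) (suc l))
    faces l (yes refl) = ⊆-closed (K k) gz-face sub
      where
      sub : fiber (g [ z ↦ suc k ]) (suc k) ⊆ fiber g (suc k) ∪ ⁅ z ⁆
      sub {y} y∈ with update-cases g z (suc k) y
      ... | inj₁ (refl , _) = q⊆p∪q (fiber g (suc k)) _ (x∈⁅x⁆ z)
      ... | inj₂ (_ , eq)   = p⊆p∪q _ (∈-fiber⁺ g (trans (sym eq) (∈-fiber⁻ (g [ z ↦ suc k ]) y∈)))
    faces l (no l≢k) = ⊆-closed (K l) (face good l) sub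
      where
      sub : fiber (g [ z ↦ suc k ]) (suc l) ⊆ fiber g (suc l)
      sub {y} y∈ with update-cases g z (suc k) y | ∈-fiber⁻ (g [ z ↦ suc k ]) y∈
      ... | inj₁ (_ , eq) | eq′ = contradiction (suc-injective (trans (sym eq′) eq)) l≢k
      ... | inj₂ (_ , eq) | eq′ = ∈-fiber⁺ g (trans (sym eq) eq′)

  -- Unavoidability is applied to the classes of `g`, each enlarged by its own free point. They stay
  -- disjoint because the points `ρ k` are distinct and unlabelled.
  matching : {g : Labelling} → Good g → {ρ : Fin (3 + s) → Fin v} → Injective _≡_ _≡_ ρ →
             (∀ k → g (ρ k) ≡ zero) → ∃[ k ] Good (g [ ρ k ↦ suc k ])
  matching {g} good {ρ} inj gρ≡0 =
    let k , face = unavoidable A disjoint in k , good-extend good face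
    where
    A : Fin (3 + s) → Subset v
    A k = fiber g (suc k) ∪ ⁅ ρ k ⁆
    cases : ∀ {k x} → x ∈ A k → g x ≡ suc k ⊎ x ≡ ρ k
    cases {k} x∈ with x∈p∪q⁻ (fiber g (suc k)) _ x∈
    ... | inj₁ x∈f = inj₁ (∈-fiber⁻ g x∈f)
    ... | inj₂ x∈ρ = inj₂ (x∈⁅y⁆⇒x≡y _ x∈ρ)
    disjoint : PairwiseDisjoint A
    disjoint i j i≢j (x , x∈) with x∈p∩q⁻ (A i) (A j) x∈
    ... | x∈i , x∈j with cases x∈i | cases x∈j
    ...   | inj₁ eq   | inj₁ eq′  = i≢j (suc-injective (trans (sym eq) eq′))
    ...   | inj₁ eq   | inj₂ refl = contradiction (trans (sym eq) (gρ≡0 j)) λ ()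
    ...   | inj₂ refl | inj₁ eq′  = contradiction (trans (sym eq′) (gρ≡0 i)) λ ()
    ...   | inj₂ eq   | inj₂ eq′  = i≢j (inj (trans (sym eq) eq′))

  -- Merging the two insertions would leave only `1 + s` unlabelled points, fewer than `gap` allows.
  conflict : {g : Labelling} → zeros g ≡ 3 + s → {z z′ : Fin v} {k k′ : Fin (3 + s)} →
             g z ≡ zero → g z′ ≡ zero → z ≢ z′ → k ≢ k′ →
             Good (g [ z ↦ suc k ]) → ¬ Good (g [ z′ ↦ suc k′ ])
  conflict {g} #g {z} {z′} {k} {k′} gz gz′ z≢z′ k≢k′ good good′ =
    <-irrefl refl (subst (2 + s ≤_) #h (gap (merge k≢k′ good good′)))
    where
    h = g [ z ↦ suc k ]
    #h : zeros (h [ z′ ↦ suc k′ ]) ≡ 1 + s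
    #h = ℕ.suc-injective (ℕ.suc-injective (trans
      (cong suc (∣fiber∣-update h z′ k′ (trans (update-≢ g (z≢z′ ∘ sym)) gz′)))
      (trans (∣fiber∣-update g z k gz) #g)))

  -- With g fixed, the pairs (k , z) for which g [ z ↦ suc k ] is good meet every
  -- matching but are never disjoint, so they form a full row or a full column.
  star : {g : Labelling} → Good g → zeros g ≡ 3 + s → {a x : Fin v} {i j : Fin (3 + s)} →
         g a ≡ zero → g x ≡ zero → a ≢ x → i ≢ j →
         Good (g [ a ↦ suc i ]) → ¬ Good (g [ a ↦ suc j ]) → Good (g [ x ↦ suc i ])
  star {g} good #g {a} {x} {i} {j} ga gx a≢x i≢j good-ai ¬good-aj
    with enumerate (3 + s) (fiber g zero) (ℕ.≤-reflexive (sym #g))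
  -- The matching offers `a` to `j` and `x` to `i`. The label `j` fails by assumption, and any label
  -- other than `i` and `j` conflicts with putting `a` under `i`, so only `i` remains.
  ... | ρ₀ , inj₀ , ρ₀∈ with prescribe₂ (λ y → g y ≡ zero) inj₀ (∈-fiber⁻ g ∘ ρ₀∈) (i≢j ∘ sym) a≢x ga gx
  ... | ρ , inj , gρ≡0 , refl , refl with matching good inj gρ≡0
  ... | k , good-k with k ≟ i
  ... | yes refl = good-k
  ... | no k≢i with k ≟ j
  ... | yes refl = contradiction good-k ¬good-aj
  ... | no k≢j = contradiction good-k (conflict #g ga (gρ≡0 k) (k≢j ∘ sym ∘ inj) (k≢i ∘ sym) good-ai)

  -- Facets: good labellings attaining the bound of `gap`

  record Facet (f : Labelling) : Set where
    field
      good  : Good f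
      tight : zeros f ≡ 2 + s

  open Facet

  zeros-cong : {f g : Labelling} → f ≗ g → zeros f ≡ zeros g
  zeros-cong f≗g = cong ∣_∣ (fiber-cong f≗g zero)

  facet-resp : {f g : Labelling} → f ≗ g → Facet f → Facet g
  facet-resp f≗g F = record
    { good  = good-resp f≗g (good F)
    ; tight = trans (sym (zeros-cong f≗g)) (tight F)
    }

  -- Starting from the empty labelling, `matching` inserts one more point as long as at least
  -- `3 + s` are unlabelled. The recursion runs on the excess over `2 + s`.
  facet-exists : ∃[ f ] Facet f
  facet-exists = search (zeros (const zero) ∸ (2 + s)) ∅-good (sym (ℕ.m∸n+n≡m (gap ∅-good)))
    where
    ∅-good : Good (const zero)
    ∅-good = mkGood λ i → ⊆-closed (K i) (⊥-face (K i)) λ x∈ →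
      contradiction (∈-fiber⁻ (const zero) {suc i} x∈) λ ()
    search : ∀ n {f} → Good f → zeros f ≡ n + (2 + s) → ∃[ f ] Facet f
    search zero    {f} good #f = f , record { good = good ; tight = #f }
    search (suc n) {f} good #f
      with enumerate (3 + s) (fiber f zero) (subst (3 + s ≤_) (sym #f) (s≤s (ℕ.m≤n+m (2 + s) n)))
    ... | ρ , inj , ρ∈ with matching good inj (∈-fiber⁻ f ∘ ρ∈)
    ... | k , good-k =
      search n good-k (ℕ.suc-injective (trans (∣fiber∣-update f (ρ k) k (∈-fiber⁻ f (ρ∈ k))) #f))

  module _ {f : Labelling} (F : Facet f) {a : Fin v} {i : Fin (3 + s)} (fa≡i : f a ≡ suc i) where

    unlabel-good : Good (f [ a ↦ zero ])
    unlabel-good = good-mono sub (good F)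
      where
      sub : ∀ {y k} → (f [ a ↦ zero ]) y ≡ suc k → f y ≡ suc k
      sub {y} eq with update-cases f a zero y
      ... | inj₁ (_ , eq′) = contradiction (trans (sym eq′) eq) λ ()
      ... | inj₂ (_ , eq′) = trans (sym eq′) eq

    unlabel-relabel : f [ a ↦ zero ] [ a ↦ suc i ] ≗ f
    unlabel-relabel y = trans (update-update f a y) (update-self f a fa≡i y)

    unlabel-zeros : zeros (f [ a ↦ zero ]) ≡ 3 + s
    unlabel-zeros = trans (sym (∣fiber∣-update (f [ a ↦ zero ]) a i (update-≡ f a)))
                      (cong suc (trans (zeros-cong unlabel-relabel) (tight F)))

    unlabel-zero : {x : Fin v} → f x ≡ zero → a ≢ x × (f [ a ↦ zero ]) x ≡ zero
    unlabel-zero {x} fx≡0 = a≢x , trans (update-≢ f (a≢x ∘ sym)) fx≡0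
      where
      a≢x : a ≢ x
      a≢x refl = contradiction (trans (sym fa≡i) fx≡0) λ ()

    reinsert : {x : Fin v} {k : Fin (3 + s)} → (f [ a ↦ zero ]) x ≡ zero →
               Good (f [ a ↦ zero ] [ x ↦ suc k ]) → Facet (f [ a ↦ zero ] [ x ↦ suc k ])
    reinsert {x} {k} gx≡0 good′ = record
      { good  = good′
      ; tight = ℕ.suc-injective (trans (∣fiber∣-update (f [ a ↦ zero ]) x k gx≡0) unlabel-zeros)
      }

    -- Exchanging `a` with an unlabelled point is a removal followed by an insertion, so `star` and
    -- `reinsert` apply to swaps.
    swap-update : {x : Fin v} → f x ≡ zero → f ∘ transpose a x ≗ f [ a ↦ zero ] [ x ↦ suc i ]
    swap-update {x} fx≡0 y =
      subst₂ (λ k l → f (transpose a x y) ≡ (f [ a ↦ k ] [ x ↦ l ]) y) fx≡0 fa≡i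
        (∘-transpose-update f (proj₁ (unlabel-zero fx≡0)) y)

  -- Movable points and their invariance under moves and swaps

  record Movable (f : Labelling) (a : Fin v) : Set where
    constructor mkMovable
    field to : ∀ k → Good (f [ a ↦ suc k ])

  open Movable

  Movable? : (f : Labelling) → Decidable (Movable f)
  Movable? f a = map′ mkMovable to (all? λ k → Good? (f [ a ↦ suc k ]))

  movable-resp : {f g : Labelling} → f ≗ g → {a : Fin v} → Movable f a → Movable g a
  movable-resp f≗g {a} mov = mkMovable λ k → good-resp (update-cong a f≗g) (to mov k)

  zero-point : {f : Labelling} → Facet f → ∃[ z ] f z ≡ zero
  zero-point {f} F =
    let ρ , _ , ρ∈ = enumerate (2 + s) (fiber f zero) (ℕ.≤-reflexive (sym (tight F))) in
    ρ zero , ∈-fiber⁻ f (ρ∈ zero)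

  -- One more labelled point would push the number of unlabelled ones below the bound of `gap`.
  saturated : {f : Labelling} → Facet f → {a : Fin v} {k : Fin (3 + s)} → f a ≡ zero →
              ¬ Good (f [ a ↦ suc k ])
  saturated {f} F {a} {k} fa≡0 good′ = <-irrefl refl
    (subst (2 + s <_) (trans (∣fiber∣-update f a k fa≡0) (tight F)) (s≤s (gap good′)))

  nonzero⇒suc : (l : Fin (4 + s)) → l ≢ zero → ∃[ i ] l ≡ suc i
  nonzero⇒suc zero    l≢0 = contradiction refl l≢0
  nonzero⇒suc (suc i) l≢0 = i , refl

  movable-label : {f : Labelling} → Facet f → {a : Fin v} → Movable f a → ∃[ i ] f a ≡ suc i
  movable-label {f} F {a} mov = nonzero⇒suc (f a) λ fa≡0 → saturated F fa≡0 (to mov zero)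

  -- One alternative label suffices. If some `l` failed for `a`, then `star` would allow an
  -- unlabelled `z` to take over the label `i`, and this conflicts with putting `a` under `j`.
  movable-intro : {f : Labelling} → Facet f → {a : Fin v} {i j : Fin (3 + s)} → f a ≡ suc i → i ≢ j →
                  Good (f [ a ↦ suc j ]) → Movable f a
  movable-intro {f} F {a} {i} {j} fa≡i i≢j good-j = mkMovable λ l → place l (Good? (f [ a ↦ suc l ]))
    where
    g = f [ a ↦ zero ]
    #g = unlabel-zeros F fa≡i
    z = proj₁ (zero-point F)
    a≢z = proj₁ (unlabel-zero F fa≡i (proj₂ (zero-point F)))
    gz = proj₂ (unlabel-zero F fa≡i (proj₂ (zero-point F)))
    ga : g a ≡ zero
    ga = update-≡ f a
    good-i : Good (g [ a ↦ suc i ])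
    good-i = good-resp (sym ∘ unlabel-relabel F fa≡i) (good F)
    good-j′ : Good (g [ a ↦ suc j ])
    good-j′ = good-resp (sym ∘ update-update f a) good-j
    place : ∀ l → Dec (Good (f [ a ↦ suc l ])) → Good (f [ a ↦ suc l ])
    place l (yes good-l) = good-l
    place l (no ¬good-l) = contradiction good-j′ (conflict #g gz ga (a≢z ∘ sym) i≢j good-zi)
      where
      i≢l : i ≢ l
      i≢l refl = ¬good-l (good-resp (sym ∘ update-self f a fa≡i) (good F))
      good-zi : Good (g [ z ↦ suc i ])
      good-zi = star (unlabel-good F fa≡i) #g ga gz a≢z i≢l good-i
                  (¬good-l ∘ good-resp (update-update f a))

  move-facet : {f : Labelling} → Facet f → {a : Fin v} → Movable f a → ∀ l → Facet (f [ a ↦ suc l ])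
  move-facet {f} F {a} mov l =
    let i , fa≡i = movable-label F mov in
    facet-resp (update-update f a)
      (reinsert F fa≡i (update-≡ f a) (good-resp (sym ∘ update-update f a) (to mov l)))

  -- For `b` other than `a`, a label `q` is chosen different from that of `b`, so that it is a
  -- genuine alternative, and from `l`, so that the two insertions merge. Then `movable-intro`
  -- applies.
  move-movable : {f : Labelling} → Facet f → {a b : Fin v} → Movable f a → ∀ l →
                 Movable f b → Movable (f [ a ↦ suc l ]) b
  move-movable {f} F {a} {b} mov-a l mov-b with b ≟ a
  ... | yes refl = mkMovable λ k → good-resp (sym ∘ update-update f a) (to mov-a k)
  ... | no b≢a =
    let p , fb≡p = movable-label F mov-b
        q , q≢p , q≢l = third p l
    in movable-intro (move-facet F mov-a l) (trans (update-≢ f b≢a) fb≡p) (q≢p ∘ sym)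
         (merge (q≢l ∘ sym) (to mov-a l) (to mov-b q))

  -- Moving `a` back to its original label restores `f`, so the forward direction applies to the
  -- reverse move.
  move-movable⁻ : {f : Labelling} → Facet f → {a b : Fin v} → Movable f a → ∀ l →
                  Movable (f [ a ↦ suc l ]) b → Movable f b
  move-movable⁻ {f} F {a} {b} mov-a l mov-b =
    let i , fa≡i = movable-label F mov-a in
    movable-resp (λ y → trans (update-update f a y) (update-self f a fa≡i y))
      (move-movable (move-facet F mov-a l) (move-movable F mov-a l mov-a) i mov-b)

  -- A labelled `a` that is not movable has a failing label, and then `star` hands its own label to
  -- `x`. If `a` is unlabelled, the swap changes nothing.
  swap-facet : {f : Labelling} → Facet f → {a x : Fin v} → ¬ Movable f a → f x ≡ zero →
               Facet (f ∘ transpose a x)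
  swap-facet {f} F {a} {x} ¬mov fx≡0 with f a in fa
  ... | zero  = facet-resp (sym ∘ ∘-transpose-trivial f (trans fa (sym fx≡0))) F
  ... | suc i with ¬∀⟶∃¬ _ _ (λ k → Good? (f [ a ↦ suc k ])) (¬mov ∘ mkMovable)
  ...   | j , ¬good-j = facet-resp (sym ∘ swap-update F fa fx≡0) (reinsert F fa gx
            (star (unlabel-good F fa) (unlabel-zeros F fa) (update-≡ f a) gx a≢x i≢j
              (good-resp (sym ∘ unlabel-relabel F fa) (good F))
              (¬good-j ∘ good-resp (update-update f a))))
    where
    a≢x = proj₁ (unlabel-zero F fa fx≡0)
    gx = proj₂ (unlabel-zero F fa fx≡0)
    i≢j : i ≢ j
    i≢j refl = ¬good-j (good-resp (sym ∘ update-self f a fa) (good F))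

  -- After `a` is removed, inserting `x` under the label `i` of `a` merges with inserting `b` under
  -- a third label `q`, which gives `b` an alternative label in the swapped facet.
  swap-movable : {f : Labelling} → Facet f → {a b x : Fin v} → f x ≡ zero → Facet (f ∘ transpose a x) →
                 Movable f b → Movable (f ∘ transpose a x) b
  swap-movable {f} F {a} {b} {x} fx≡0 F′ mov with f a in fa
  ... | zero  = movable-resp (sym ∘ ∘-transpose-trivial f (trans fa (sym fx≡0))) mov
  ... | suc i = movable-resp (sym ∘ swap-update F fa fx≡0) mov′
    where
    g = f [ a ↦ zero ]
    a≢x = proj₁ (unlabel-zero F fa fx≡0)
    gx = proj₂ (unlabel-zero F fa fx≡0)
    G : Facet (g [ x ↦ suc i ])
    G = facet-resp (swap-update F fa fx≡0) F′
    b≢x : b ≢ x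
    b≢x refl = saturated F fx≡0 (to mov zero)
    mov′ : Movable (g [ x ↦ suc i ]) b
    mov′ with movable-label F mov
    ... | p , fb≡p with third p i
    ...   | q , q≢p , q≢i with b ≟ a
    -- The case that `a` itself is movable is impossible: `a` under `q` and `x` under `i` would both
    -- be good after the removal, against `conflict`.
    ...     | yes refl = contradiction (good-resp (sym ∘ update-update f a) (to mov q))
                (conflict (unlabel-zeros F fa) gx (update-≡ f a) (a≢x ∘ sym) (q≢i ∘ sym) (good G))
    ...     | no b≢a = movable-intro G (trans (update-≢ g b≢x) (trans (update-≢ f b≢a) fb≡p)) (q≢p ∘ sym)
                (merge (q≢i ∘ sym) (good G) (good-mono sub (to mov q)))
      where
      sub : ∀ {y k} → (g [ b ↦ suc q ]) y ≡ suc k → (f [ b ↦ suc q ]) y ≡ suc k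
      sub {y} eq with update-cases g b (suc q) y
      ... | inj₁ (refl , eq′) = trans (update-≡ f b) (trans (sym eq′) eq)
      ... | inj₂ (y≢b , eq′) with update-cases f a zero y
      ...   | inj₁ (_ , eq″) = contradiction (trans (sym eq″) (trans (sym eq′) eq)) λ ()
      ...   | inj₂ (_ , eq″) = trans (update-≢ f y≢b) (trans (sym eq″) (trans (sym eq′) eq))

  swap-movable⁻ : {f : Labelling} → Facet f → {a b x : Fin v} → f x ≡ zero → Facet (f ∘ transpose a x) →
                  Movable (f ∘ transpose a x) b → Movable f b
  swap-movable⁻ {f} F {a} {b} {x} fx≡0 F′ mov =
    movable-resp back (swap-movable F′ {x} {b} {a} (trans (cong f (transpose-ˡ a x)) fx≡0)
      (facet-resp (sym ∘ back) F) mov)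
    where
    back : f ∘ transpose a x ∘ transpose x a ≗ f
    back y = cong f (transpose-inverse a x)

  -- Faces are determined by their number of fixed points

  module Classification {f₀ : Labelling} (F₀ : Facet f₀) where

    Fixed : Fin v → Set
    Fixed x = ¬ Movable f₀ x

    Fixed? : Decidable Fixed
    Fixed? x = ¬? (Movable? f₀ x)

    V₀ : Subset v
    V₀ = toSubset Fixed?

    -- The values at `suc i` become the column capacities of the chessboard; the value at `zero`
    -- enters the count of its rows.
    mult : Fin (4 + s) → ℕ
    mult l = ∣ fiber f₀ l ∩ V₀ ∣

    -- This records the invariants of moves and swaps rather than a history of them.
    record Reachable (f : Labelling) : Set where
      field
        facet    : Facet f
        movable⁺ : ∀ {x} → Movable f₀ x → Movable f x
        movable⁻ : ∀ {x} → Movable f x → Movable f₀ x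
        count    : ∀ l → ∣ fiber f l ∩ V₀ ∣ ≡ mult l

    open Reachable

    reachable₀ : Reachable f₀
    reachable₀ = record
      { facet = F₀ ; movable⁺ = λ m → m ; movable⁻ = λ m → m ; count = λ _ → refl }

    reach-move : {f : Labelling} → Reachable f → {w : Fin v} → Movable f₀ w → ∀ k → Reachable (f [ w ↦ suc k ])
    reach-move {f} R {w} mov k = record
      { facet    = move-facet (facet R) (movable⁺ R mov) k
      ; movable⁺ = move-movable (facet R) (movable⁺ R mov) k ∘ movable⁺ R
      ; movable⁻ = movable⁻ R ∘ move-movable⁻ (facet R) (movable⁺ R mov) k
      ; count    = λ l → trans (cong ∣_∣ (⊆-antisym (forth l) (back l))) (count R l)
      }
      where
      w≢ : ∀ {x} → x ∈ V₀ → x ≢ w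
      w≢ x∈V₀ refl = ∈-toSubset⁻ Fixed? x∈V₀ mov
      forth : ∀ l → fiber (f [ w ↦ suc k ]) l ∩ V₀ ⊆ fiber f l ∩ V₀
      forth l x∈ =
        let x∈f , x∈V₀ = x∈p∩q⁻ _ V₀ x∈ in
        x∈p∩q⁺ (∈-fiber⁺ f (trans (sym (update-≢ f (w≢ x∈V₀))) (∈-fiber⁻ (f [ w ↦ suc k ]) x∈f)) , x∈V₀)
      back : ∀ l → fiber f l ∩ V₀ ⊆ fiber (f [ w ↦ suc k ]) l ∩ V₀
      back l x∈ =
        let x∈f , x∈V₀ = x∈p∩q⁻ _ V₀ x∈ in
        x∈p∩q⁺ (∈-fiber⁺ (f [ w ↦ suc k ]) (trans (update-≢ f (w≢ x∈V₀)) (∈-fiber⁻ f x∈f)) , x∈V₀)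

    -- The transposition of two fixed points maps `V₀` into itself and carries each class of the
    -- swapped labelling into the same class of `f`.
    swap-count-≤ : (f : Labelling) {a x : Fin v} → a ∈ V₀ → x ∈ V₀ → ∀ l →
                   ∣ fiber (f ∘ transpose a x) l ∩ V₀ ∣ ≤ ∣ fiber f l ∩ V₀ ∣
    swap-count-≤ f {a} {x} a∈ x∈ l = injective⇒∣p∣≤∣q∣ _ _ (λ {y} _ → transpose a x y)
      (λ _ _ → transpose-injective a x)
      λ y∈ → let y∈f , y∈V₀ = x∈p∩q⁻ _ V₀ y∈ in
        x∈p∩q⁺ ( ∈-fiber⁺ f (∈-fiber⁻ (f ∘ transpose a x) y∈f)
               , transpose-preserves (_∈ V₀) a∈ x∈ y∈V₀)

    swap-count : (f : Labelling) {a x : Fin v} → a ∈ V₀ → x ∈ V₀ → ∀ l →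
                 ∣ fiber (f ∘ transpose a x) l ∩ V₀ ∣ ≡ ∣ fiber f l ∩ V₀ ∣
    swap-count f {a} {x} a∈ x∈ l = ≤-antisym (swap-count-≤ f a∈ x∈ l)
      (subst (λ p → ∣ p ∩ V₀ ∣ ≤ ∣ fiber (f ∘ transpose a x) l ∩ V₀ ∣)
        (fiber-cong (λ y → cong f (transpose-inverse a x)) l)
        (swap-count-≤ (f ∘ transpose a x) x∈ a∈ l))

    zero-fixed : {f : Labelling} → Reachable f → {x : Fin v} → f x ≡ zero → Fixed x
    zero-fixed R fx≡0 mov = saturated (facet R) fx≡0 (to (movable⁺ R mov) zero)

    -- The unlabelled `x` is fixed as well, by `zero-fixed`, so the swap permutes `V₀` and preserves
    -- the counts.
    reach-swap : {f : Labelling} → Reachable f → {a x : Fin v} → Fixed a → f x ≡ zero →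
                 Reachable (f ∘ transpose a x)
    reach-swap {f} R {a} {x} fixed fx≡0 = record
      { facet    = F′
      ; movable⁺ = swap-movable (facet R) fx≡0 F′ ∘ movable⁺ R
      ; movable⁻ = movable⁻ R ∘ swap-movable⁻ (facet R) fx≡0 F′
      ; count    = λ l → trans (swap-count f (∈-toSubset⁺ Fixed? fixed)
                                  (∈-toSubset⁺ Fixed? (zero-fixed R fx≡0)) l) (count R l)
      }
      where
      F′ : Facet (f ∘ transpose a x)
      F′ = swap-facet (facet R) (fixed ∘ movable⁻ R) fx≡0

    Agree : Fin (3 + s) → (Fin v → Set) → Labelling → Labelling → Set
    Agree i Except f f′ = ∀ u → ¬ Except u → (f u ≡ suc i → f′ u ≡ suc i) × (f′ u ≡ suc i → f u ≡ suc i)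

    -- Swapping `y` with an unlabelled `z` hands `z` the old label of `y`, which is not `suc i`, so
    -- the class of `i` is undisturbed.
    vacate : {f : Labelling} → Reachable f → {y : Fin v} {i : Fin (3 + s)} → Fixed y → f y ≢ suc i →
           ∃[ f′ ] Reachable f′ × f′ y ≡ zero × Agree i (_≡ y) f f′
    vacate {f} R {y} {i} fixed fy≢i =
        f ∘ transpose y z
      , reach-swap R fixed fz≡0
      , trans (cong f (transpose-ˡ y z)) fz≡0
      , agree
      where
      z = proj₁ (zero-point (facet R))
      fz≡0 = proj₂ (zero-point (facet R))
      agree : Agree i (_≡ y) f (f ∘ transpose y z)
      agree u u≢y with u ≟ z
      ... | yes refl = (λ eq → contradiction (trans (sym fz≡0) eq) λ ())
                     , λ eq → contradiction (trans (sym (cong f (transpose-ʳ y z))) eq) fy≢i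
      ... | no u≢z = trans same , trans (sym same)
        where
        same : f (transpose y z u) ≡ f u
        same = cong f (transpose-≢ u≢y u≢z)

    -- Two swaps: first `y` is made unlabelled, then it trades places with `b`, which thereby
    -- becomes unlabelled.
    exchange : {f : Labelling} → Reachable f → {y b : Fin v} {i : Fin (3 + s)} →
               Fixed y → Fixed b → f y ≢ suc i → f b ≡ suc i →
               ∃[ f′ ] Reachable f′ × f′ y ≡ suc i × f′ b ≢ suc i × Agree i (λ u → u ≡ y ⊎ u ≡ b) f f′
    exchange {f} R {y} {b} {i} fixed-y fixed-b fy≢i fb≡i with vacate R fixed-y fy≢i
    ... | f₁ , R₁ , f₁y≡0 , agree =
        f₁ ∘ transpose b y
      , reach-swap R₁ fixed-b f₁y≡0
      , trans (cong f₁ (transpose-ʳ b y)) (proj₁ (agree b b≢y) fb≡i)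
      , (λ eq → contradiction (trans (sym f₁y≡0) (trans (sym (cong f₁ (transpose-ˡ b y))) eq)) λ ())
      , λ u u≢ →
          let same = cong f₁ (transpose-≢ (u≢ ∘ inj₂) (u≢ ∘ inj₁))
              forth , back = agree u (u≢ ∘ inj₁)
          in trans same ∘ forth , back ∘ trans (sym same)
      where
      b≢y : b ≢ y
      b≢y refl = fy≢i fb≡i

    module _ (i : Fin (3 + s)) (A : Subset v) where

      private
        missing? : (f : Labelling) → Decidable (λ x → x ∈ A × f x ≢ suc i)
        missing? f x = (x ∈? A) ×-dec ¬? (f x ≟ suc i)

        excess? : (f : Labelling) → Decidable (λ x → x ∉ A × f x ≡ suc i)
        excess? f x = ¬? (x ∈? A) ×-dec (f x ≟ suc i)

      -- Descent on the members of `A` missing from the class of `i`. A movable one is moved in. For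
      -- a fixed one, the bound provides a fixed point of the class outside `A` to exchange it with.
      -- At the end `A` lies inside the class.
      face⁺ : ∣ A ∩ V₀ ∣ ≤ mult (suc i) → Face (K i) A
      face⁺ small = search reachable₀ (<-wellFounded _)
        where
        search : {f : Labelling} → Reachable f → Acc _<_ ∣ toSubset (missing? f) ∣ → Face (K i) A
        search {f} R (acc rec) with any? (missing? f)
        ... | no none = ⊆-closed (K i) (face (good (facet R)) i) A⊆
          where
          A⊆ : A ⊆ fiber f (suc i)
          A⊆ {x} x∈ with f x ≟ suc i
          ... | yes fx≡i = ∈-fiber⁺ f fx≡i
          ... | no fx≢i  = contradiction (x , x∈ , fx≢i) none
        ... | yes (y , y∈A , fy≢i) with Movable? f₀ y
        ...   | yes mov = search (reach-move R mov i) (rec (p⊂q⇒∣p∣<∣q∣ (sub , y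
                  , ∈-toSubset⁺ (missing? f) (y∈A , fy≢i)
                  , λ y∈ → proj₂ (∈-toSubset⁻ (missing? (f [ y ↦ suc i ])) y∈) (update-≡ f y))))
          where
          sub : toSubset (missing? (f [ y ↦ suc i ])) ⊆ toSubset (missing? f)
          sub {u} u∈ with ∈-toSubset⁻ (missing? (f [ y ↦ suc i ])) u∈ | update-cases f y (suc i) u
          ... | u∈A , f′u≢i | inj₁ (_ , eq) = contradiction eq f′u≢i
          ... | u∈A , f′u≢i | inj₂ (_ , eq) = ∈-toSubset⁺ (missing? f) (u∈A , f′u≢i ∘ trans eq)
        ...   | no fixed-y
          with ∣p∣≤∣q∣∧p⊈q⇒∃∈q∉p {p = A ∩ V₀} {fiber f (suc i) ∩ V₀}
                 (≤-trans small (ℕ.≤-reflexive (sym (count R (suc i)))))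
                 (x∈p∩q⁺ (y∈A , ∈-toSubset⁺ Fixed? fixed-y))
                 (fy≢i ∘ ∈-fiber⁻ f ∘ proj₁ ∘ x∈p∩q⁻ _ V₀)
        ... | b , b∈ , b∉ with x∈p∩q⁻ (fiber f (suc i)) V₀ b∈
        ... | b∈f , b∈V₀ with exchange R fixed-y (∈-toSubset⁻ Fixed? b∈V₀) fy≢i (∈-fiber⁻ f b∈f)
        ... | f′ , R′ , f′y≡i , f′b≢i , agree = search R′ (rec (p⊂q⇒∣p∣<∣q∣ (sub , y
                , ∈-toSubset⁺ (missing? f) (y∈A , fy≢i)
                , λ y∈ → proj₂ (∈-toSubset⁻ (missing? f′) y∈) f′y≡i)))
          where
          sub : toSubset (missing? f′) ⊆ toSubset (missing? f)
          sub {u} u∈ with ∈-toSubset⁻ (missing? f′) u∈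
          ... | u∈A , f′u≢i = ∈-toSubset⁺ (missing? f) (u∈A , f′u≢i ∘ proj₁ (agree u
            λ { (inj₁ refl) → f′u≢i f′y≡i ; (inj₂ refl) → b∉ (x∈p∩q⁺ (u∈A , b∈V₀)) }))

      -- If `A` had too many fixed points, descent on the points of the class of `i` outside `A`
      -- would remove them all: movable ones change label, fixed ones are exchanged for fixed points
      -- of `A`. A facet whose class lies inside `A` could then be extended.
      face⁻ : Face (K i) A → ∣ A ∩ V₀ ∣ ≤ mult (suc i)
      face⁻ A∈K = ℕ.≮⇒≥ λ large → search large reachable₀ (<-wellFounded _)
        where
        search : mult (suc i) < ∣ A ∩ V₀ ∣ → {f : Labelling} → Reachable f →
                 Acc _<_ ∣ toSubset (excess? f) ∣ → Empty.⊥
        search large {f} R (acc rec) with any? (excess? f)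
        ... | no none with ∣p∣<∣q∣⇒∃∈q∉p (subst (_< ∣ A ∩ V₀ ∣) (sym (count R (suc i))) large)
        ...   | y , y∈ , y∉ with x∈p∩q⁻ A V₀ y∈
        ...   | y∈A , y∈V₀
          -- The spare fixed point `y` of `A` must be unlabelled before `saturated` can refuse its
          -- insertion.
          with vacate R {i = i} (∈-toSubset⁻ Fixed? y∈V₀) (λ eq → y∉ (x∈p∩q⁺ (∈-fiber⁺ f eq , y∈V₀)))
        ...   | f′ , R′ , f′y≡0 , agree =
          saturated (facet R′) f′y≡0 (good-extend (good (facet R′)) (⊆-closed (K i) A∈K ⊆A))
          where
          ⊆A : fiber f′ (suc i) ∪ ⁅ y ⁆ ⊆ A
          ⊆A {u} u∈ with x∈p∪q⁻ (fiber f′ (suc i)) _ u∈ | u ∈? A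
          ... | _ | yes u∈A = u∈A
          ... | inj₂ u∈y | no u∉A = contradiction (subst (_∈ A) (sym (x∈⁅y⁆⇒x≡y y u∈y)) y∈A) u∉A
          ... | inj₁ u∈f′ | no u∉A =
            contradiction (u , u∉A , proj₂ (agree u λ { refl → u∉A y∈A }) (∈-fiber⁻ f′ u∈f′)) none
        search large {f} R (acc rec) | yes (b , b∉A , fb≡i) with Movable? f₀ b
        ... | yes mov = search large (reach-move R mov j) (rec (p⊂q⇒∣p∣<∣q∣ (sub , b
                  , ∈-toSubset⁺ (excess? f) (b∉A , fb≡i)
                  , λ b∈ → contradiction (suc-injective (trans (sym (update-≡ f b))
                      (proj₂ (∈-toSubset⁻ (excess? (f [ b ↦ suc j ])) b∈)))) j≢i)))
          where
          j = proj₁ (third i i)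
          j≢i = proj₁ (proj₂ (third i i))
          sub : toSubset (excess? (f [ b ↦ suc j ])) ⊆ toSubset (excess? f)
          sub {u} u∈ with ∈-toSubset⁻ (excess? (f [ b ↦ suc j ])) u∈ | update-cases f b (suc j) u
          ... | u∉A , f′u≡i | inj₁ (_ , eq) = contradiction (suc-injective (trans (sym eq) f′u≡i)) j≢i
          ... | u∉A , f′u≡i | inj₂ (_ , eq) = ∈-toSubset⁺ (excess? f) (u∉A , trans (sym eq) f′u≡i)
        ... | no fixed-b
          with ∣p∣≤∣q∣∧p⊈q⇒∃∈q∉p {p = fiber f (suc i) ∩ V₀} {A ∩ V₀}
                 (≤-trans (ℕ.≤-reflexive (count R (suc i))) (ℕ.<⇒≤ large))
                 (x∈p∩q⁺ (∈-fiber⁺ f fb≡i , ∈-toSubset⁺ Fixed? fixed-b))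
                 (b∉A ∘ proj₁ ∘ x∈p∩q⁻ A V₀)
        ... | y , y∈ , y∉ with x∈p∩q⁻ A V₀ y∈
        ... | y∈A , y∈V₀ with exchange R {i = i} (∈-toSubset⁻ Fixed? y∈V₀) fixed-b
                                (λ eq → y∉ (x∈p∩q⁺ (∈-fiber⁺ f eq , y∈V₀))) fb≡i
        ... | f′ , R′ , f′y≡i , f′b≢i , agree = search large R′ (rec (p⊂q⇒∣p∣<∣q∣ (sub , b
                , ∈-toSubset⁺ (excess? f) (b∉A , fb≡i)
                , λ b∈ → f′b≢i (proj₂ (∈-toSubset⁻ (excess? f′) b∈)))))
          where
          sub : toSubset (excess? f′) ⊆ toSubset (excess? f)
          sub {u} u∈ with ∈-toSubset⁻ (excess? f′) u∈
          ... | u∉A , f′u≡i = ∈-toSubset⁺ (excess? f) (u∉A , proj₂ (agree u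
            λ { (inj₁ refl) → u∉A y∈A ; (inj₂ refl) → f′b≢i f′u≡i }) f′u≡i)

-- From threshold complexes to the chessboard complex

module ∑ = Sum +-0-commutativeMonoid

indicator : Fin t → Fin t → ℕ
indicator a b = if does (a ≟ b) then 1 else 0

sum-indicator : (a : Fin t) → ∑.sum (indicator a) ≡ 1
sum-indicator {suc t} zero    = cong suc (∑.sum-replicate-zero t)
sum-indicator {suc t} (suc a) = sum-indicator a

-- Each member of `p` lies in exactly one fiber, so it contributes one `indicator`, of total 1.
sum-fibers : (f : Fin v → Fin t) (p : Subset v) → ∑.sum (λ l → ∣ fiber f l ∩ p ∣) ≡ ∣ p ∣
sum-fibers {t = t} f [] = ∑.sum-replicate-zero t
sum-fibers f (outside ∷ p) = trans (∑.sum-cong-≗ drop) (sum-fibers (f ∘ suc) p)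
  where
  drop : ∀ l → ∣ fiber f l ∩ (outside ∷ p) ∣ ≡ ∣ fiber (f ∘ suc) l ∩ p ∣
  drop l with does (f zero ≟ l)
  ... | true  = refl
  ... | false = refl
sum-fibers f (inside ∷ p) = trans (∑.sum-cong-≗ split)
  (trans (∑.∑-distrib-+ (indicator (f zero)) (λ l → ∣ fiber (f ∘ suc) l ∩ p ∣))
    (cong₂ _+_ (sum-indicator (f zero)) (sum-fibers (f ∘ suc) p)))
  where
  split : ∀ l → ∣ fiber f l ∩ (inside ∷ p) ∣ ≡ indicator (f zero) l + ∣ fiber (f ∘ suc) l ∩ p ∣
  split l with does (f zero ≟ l)
  ... | true  = refl
  ... | false = refl

x∈p⇒1≤∣p∣ : {p : Subset n} {x : Fin n} → x ∈ p → 1 ≤ ∣ p ∣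
x∈p⇒1≤∣p∣ x∈p = ≤-trans (s≤s z≤n) (x∈p⇒∣p-x∣<∣p∣ x∈p)

∣p∣≤1⇒subsingleton : {p : Subset n} → ∣ p ∣ ≤ 1 → {x y : Fin n} → x ∈ p → y ∈ p → x ≡ y
∣p∣≤1⇒subsingleton ∣p∣≤1 {x} {y} x∈p y∈p with x ≟ y
... | yes x≡y = x≡y
... | no x≢y  = contradiction
  (≤-trans (s≤s (x∈p⇒1≤∣p∣ (x∈p∧x≢y⇒x∈p-y y∈p (x≢y ∘ sym)))) (≤-trans (x∈p⇒∣p-x∣<∣p∣ x∈p) ∣p∣≤1))
  λ { (s≤s ()) }

subsingleton⇒∣p∣≤1 : {p : Subset n} → (∀ {x y} → x ∈ p → y ∈ p → x ≡ y) → ∣ p ∣ ≤ 1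
subsingleton⇒∣p∣≤1 {p = p} sub =
  injective⇒∣p∣≤∣q∣ p (⊤ {1}) (λ _ → zero) (λ x∈ y∈ _ → sub x∈ y∈) (λ _ → ∈⊤)

preimage-∘ : (f : Fin l → Fin m) (g : Fin m → Fin n) (S : Subset n) →
             preimage f (preimage g S) ≡ preimage (g ∘ f) S
preimage-∘ f g S = tabulate-cong λ x → lookup∘tabulate (lookup S ∘ g) (f x)

preimage-cong : {f g : Fin m → Fin n} → f ≗ g → (S : Subset n) → preimage f S ≡ preimage g S
preimage-cong f≗g S = tabulate-cong λ x → cong (lookup S) (f≗g x)

-- A point common to columns `i` and `j` is a row containing both `i` and `j`.
disjoint⇔rows : (S : Subset (v * r)) →
  PairwiseDisjoint (λ i → column {v} i S) ⇔ (∀ x → ∣ row {v} {r} x S ∣ ≤ 1)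
disjoint⇔rows {v} {r} S = mk⇔ to from
  where
  to : PairwiseDisjoint (λ i → column {v} i S) → ∀ x → ∣ row {v} {r} x S ∣ ≤ 1
  to disjoint x = subsingleton⇒∣p∣≤1 sub
    where
    sub : ∀ {i j} → i ∈ row {v} {r} x S → j ∈ row {v} x S → i ≡ j
    sub {i} {j} i∈ j∈ with i ≟ j
    ... | yes i≡j = i≡j
    ... | no i≢j  = contradiction (x , x∈p∩q⁺
      ( ∈-preimage⁺ (λ y → combine y i) (∈-preimage⁻ (combine x) {S} i∈)
      , ∈-preimage⁺ (λ y → combine y j) (∈-preimage⁻ (combine x) {S} j∈))) (disjoint i j i≢j)
  from : (∀ x → ∣ row {v} {r} x S ∣ ≤ 1) → PairwiseDisjoint (λ i → column {v} i S)
  from rows i j i≢j (x , x∈) =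
    let x∈i , x∈j = x∈p∩q⁻ (column {v} i S) _ x∈ in
    i≢j (∣p∣≤1⇒subsingleton (rows x)
      (∈-preimage⁺ (combine x) (∈-preimage⁻ (λ y → combine y i) {S} x∈i))
      (∈-preimage⁺ (combine x) (∈-preimage⁻ (λ y → combine y j) {S} x∈j)))

-- The join factors occupy consecutive blocks of length `r`, which `combine` identifies with the
-- rows of a `k` by `r` board. The join is thus a chessboard with only the row condition.
joinPower-face : ∀ k (T : Subset (k * r)) →
                 Face (joinPower (points r) k) T ⇔ (∀ x → ∣ row {k} {r} x T ∣ ≤ 1)
joinPower-face zero    T = mk⇔ (λ _ ()) (λ _ → tt)
joinPower-face {r} (suc k) T = mk⇔ to from
  where
  open Equivalence (joinPower-face {r} k (preimage (r ↑ʳ_) T)) renaming (to to rest⁺; from to rest⁻)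
  shift : ∀ x → row {k} {r} x (preimage (r ↑ʳ_) T) ≡ row {suc k} {r} (suc x) T
  shift x = preimage-∘ (combine x) (r ↑ʳ_) T
  to : Face (joinPower (points r) (suc k)) T → ∀ x → ∣ row {suc k} {r} x T ∣ ≤ 1
  to (first , rest) zero    = first
  to (first , rest) (suc x) = subst (λ p → ∣ p ∣ ≤ 1) (shift x) (rest⁺ rest x)
  from : (∀ x → ∣ row {suc k} {r} x T ∣ ≤ 1) → Face (joinPower (points r) (suc k)) T
  from rows = rows zero , rest⁻ λ x → subst (λ p → ∣ p ∣ ≤ 1) (sym (shift x)) (rows (suc x))

-- Separating fixed from movable vertices

record Splitting (P : Pred (Fin v) 0ℓ) : Set where
  field
    {#in #out} : ℕ
    bijection  : (Fin #in ⊎ Fin #out) ↔ Fin v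
    inside-P   : ∀ x → P (Inverse.to bijection (inj₁ x))
    outside-P  : ∀ y → ¬ P (Inverse.to bijection (inj₂ y))

split : {P : Pred (Fin v) 0ℓ} → Decidable P → Splitting P
split {zero} P? = record
  { #in = 0 ; #out = 0
  ; bijection = mk↔ₛ′ (λ { (inj₁ ()) ; (inj₂ ()) }) (λ ()) (λ ()) (λ { (inj₁ ()) ; (inj₂ ()) })
  ; inside-P = λ () ; outside-P = λ () }
split {suc v} {P} P? with split (P? ∘ suc) | P? zero
... | rest | yes P0 = record
  { #in = suc #in ; #out = #out
  ; bijection = mk↔ₛ′ to′ from′ to-from from-to
  ; inside-P = λ { zero → P0 ; (suc x) → inside-P x } ; outside-P = outside-P }
  where
  open Splitting rest
  open Inverse bijection
  to′ : Fin (suc #in) ⊎ Fin #out → Fin (suc v)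
  to′ (inj₁ zero)    = zero
  to′ (inj₁ (suc x)) = suc (to (inj₁ x))
  to′ (inj₂ y)       = suc (to (inj₂ y))
  grow : Fin #in ⊎ Fin #out → Fin (suc #in) ⊎ Fin #out
  grow = map₁ suc
  from′ : Fin (suc v) → Fin (suc #in) ⊎ Fin #out
  from′ zero    = inj₁ zero
  from′ (suc z) = grow (from z)
  to-grow : ∀ s → to′ (grow s) ≡ suc (to s)
  to-grow (inj₁ _) = refl
  to-grow (inj₂ _) = refl
  to-from : ∀ z → to′ (from′ z) ≡ z
  to-from zero    = refl
  to-from (suc z) = trans (to-grow (from z)) (cong suc (strictlyInverseˡ z))
  from-to : ∀ s → from′ (to′ s) ≡ s
  from-to (inj₁ zero)    = refl
  from-to (inj₁ (suc x)) = cong grow (strictlyInverseʳ (inj₁ x))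
  from-to (inj₂ y)       = cong grow (strictlyInverseʳ (inj₂ y))
... | rest | no ¬P0 = record
  { #in = #in ; #out = suc #out
  ; bijection = mk↔ₛ′ to′ from′ to-from from-to
  ; inside-P = inside-P ; outside-P = λ { zero → ¬P0 ; (suc y) → outside-P y } }
  where
  open Splitting rest
  open Inverse bijection
  to′ : Fin #in ⊎ Fin (suc #out) → Fin (suc v)
  to′ (inj₁ x)       = suc (to (inj₁ x))
  to′ (inj₂ zero)    = zero
  to′ (inj₂ (suc y)) = suc (to (inj₂ y))
  grow : Fin #in ⊎ Fin #out → Fin #in ⊎ Fin (suc #out)
  grow = map₂ suc
  from′ : Fin (suc v) → Fin #in ⊎ Fin (suc #out)
  from′ zero    = inj₂ zero
  from′ (suc z) = grow (from z)
  to-grow : ∀ s → to′ (grow s) ≡ suc (to s)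
  to-grow (inj₁ _) = refl
  to-grow (inj₂ _) = refl
  to-from : ∀ z → to′ (from′ z) ≡ z
  to-from zero    = refl
  to-from (suc z) = trans (to-grow (from z)) (cong suc (strictlyInverseˡ z))
  from-to : ∀ s → from′ (to′ s) ≡ s
  from-to (inj₁ x)       = cong grow (strictlyInverseʳ (inj₁ x))
  from-to (inj₂ zero)    = refl
  from-to (inj₂ (suc y)) = cong grow (strictlyInverseʳ (inj₂ y))

module _ {n k : ℕ} (σ : (Fin n ⊎ Fin k) ↔ Fin v) where

  open Inverse σ using (to; from; strictlyInverseˡ; strictlyInverseʳ)

  -- Both inequalities come from injections: `to ∘ inj₁` one way, and its inverse, available on `V`
  -- only, the other way.
  ∣preimage∣ : {V : Subset v} → (∀ x → to (inj₁ x) ∈ V) → (∀ y → to (inj₂ y) ∉ V) →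
               (A : Subset v) → ∣ preimage (to ∘ inj₁) A ∣ ≡ ∣ A ∩ V ∣
  ∣preimage∣ {V} ∈V ∉V A = ≤-antisym
    (injective⇒∣p∣≤∣q∣ (preimage (to ∘ inj₁) A) (A ∩ V) (λ {x} _ → to (inj₁ x))
      (λ {x} {y} _ _ eq → inj₁-injective (trans (sym (strictlyInverseʳ (inj₁ x)))
        (trans (cong from eq) (strictlyInverseʳ (inj₁ y)))))
      λ {x} x∈ → x∈p∩q⁺ (∈-preimage⁻ (to ∘ inj₁) x∈ , ∈V x))
    (injective⇒∣p∣≤∣q∣ (A ∩ V) (preimage (to ∘ inj₁) A) (λ x∈ → proj₁ (back x∈))
      (λ x∈ y∈ eq → trans (sym (proj₂ (back x∈))) (trans (cong (to ∘ inj₁) eq) (proj₂ (back y∈))))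
      λ x∈ → ∈-preimage⁺ (to ∘ inj₁)
        (subst (_∈ A) (sym (proj₂ (back x∈))) (proj₁ (x∈p∩q⁻ A V x∈))))
    where
    back : ∀ {x} → x ∈ A ∩ V → ∃[ z ] to (inj₁ z) ≡ x
    back {x} x∈ with from x | strictlyInverseˡ x
    ... | inj₁ z | eq = z , eq
    ... | inj₂ y | eq = contradiction (subst (_∈ V) (sym eq) (proj₂ (x∈p∩q⁻ A V x∈))) (∉V y)

  ⊎-blocks : (r : ℕ) → (Fin (n * r) ⊎ Fin (k * r)) ↔ Fin (v * r)
  ⊎-blocks r = ↔-trans (*↔× {n} {r} ⊎-↔ *↔× {k} {r})
                 (↔-trans (↔-sym ×-distribʳ-⊎) (↔-trans (σ ×-↔ ↔-refl) (↔-sym (*↔× {v} {r}))))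

  blocks : (r : ℕ) → Fin (n * r + k * r) ↔ Fin (v * r)
  blocks r = ↔-trans (+↔⊎ {n * r} {k * r}) (⊎-blocks r)

  blocks-ˡ : (x : Fin n) (i : Fin r) →
             Inverse.to (blocks r) (combine x i ↑ˡ (k * r)) ≡ combine (to (inj₁ x)) i
  blocks-ˡ {r} x i =
    trans (cong (Inverse.to (⊎-blocks r)) (splitAt-↑ˡ (n * r) (combine x i) (k * r)))
          (cong (λ (x , i) → combine (to (inj₁ x)) i) (remQuot-combine x i))

  blocks-ʳ : (y : Fin k) (i : Fin r) →
             Inverse.to (blocks r) ((n * r) ↑ʳ combine y i) ≡ combine (to (inj₂ y)) i
  blocks-ʳ {r} y i =
    trans (cong (Inverse.to (⊎-blocks r)) (splitAt-↑ʳ (n * r) (k * r) (combine y i)))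
          (cong (λ (y , i) → combine (to (inj₂ y)) i) (remQuot-combine y i))

  -- The face conditions restrict only the columns of the first block. Disjointness is the condition
  -- on all rows, which is divided between the chessboard and the join power.
  deletedJoin-≅ : (K : Fin r → Complex v) (mult : Fin r → ℕ) →
    (∀ i A → Face (K i) A ⇔ ∣ preimage (to ∘ inj₁) A ∣ ≤ mult i) →
    deletedJoin K ≅ (chessboard n r mult *ʲ joinPower (points r) k)
  deletedJoin-≅ {r} K mult K-face = record
    -- An isomorphism pulls faces back along the inverse of `vertices`, which is then `blocks r`
    -- itself.
    { vertices = ↔-sym (blocks r)
    ; faces    = λ S → mk⇔ (forth S) (back S)
    }
    where
    β = Inverse.to (blocks r)
    left right : (S : Subset (v * r)) → Subset _
    left  S = preimage (_↑ˡ (k * r)) (preimage β S)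
    right S = preimage ((n * r) ↑ʳ_) (preimage β S)
    column-left : ∀ i S → column {n} i (left S) ≡ preimage (to ∘ inj₁) (column {v} i S)
    column-left i S =
      trans (preimage-∘ (λ (x : Fin n) → combine x i) (_↑ˡ (k * r)) (preimage β S))
      (trans (preimage-∘ (λ (x : Fin n) → combine x i ↑ˡ (k * r)) β S)
      (trans (preimage-cong (λ x → blocks-ˡ x i) S)
      (sym (preimage-∘ (to ∘ inj₁) (λ x → combine x i) S))))
    row-left : ∀ x S → row {n} {r} x (left S) ≡ row {v} (to (inj₁ x)) S
    row-left x S =
      trans (preimage-∘ (combine x) (_↑ˡ (k * r)) (preimage β S))
      (trans (preimage-∘ (λ i → combine x i ↑ˡ (k * r)) β S) (preimage-cong (blocks-ˡ x) S))
    row-right : ∀ y S → row {k} {r} y (right S) ≡ row {v} (to (inj₂ y)) S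
    row-right y S =
      trans (preimage-∘ (combine y) ((n * r) ↑ʳ_) (preimage β S))
      (trans (preimage-∘ (λ i → (n * r) ↑ʳ combine y i) β S) (preimage-cong (blocks-ʳ y) S))
    rows : (S : Subset (v * r)) → Set
    rows S = ∀ x → ∣ row {v} {r} x S ∣ ≤ 1
    forth : ∀ S → Face (deletedJoin K) S →
            Face (chessboard n r mult *ʲ joinPower (points r) k) (preimage β S)
    forth S (cols , disjoint) =
        ( (λ i → subst (λ p → ∣ p ∣ ≤ mult i) (sym (column-left i S)) (Equivalence.to (K-face i _) (cols i)))
        , λ x → subst (λ p → ∣ p ∣ ≤ 1) (sym (row-left x S)) (rows-S (to (inj₁ x))))
      , Equivalence.from (joinPower-face k (right S))
          λ y → subst (λ p → ∣ p ∣ ≤ 1) (sym (row-right y S)) (rows-S (to (inj₂ y)))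
      where
      rows-S : rows S
      rows-S = Equivalence.to (disjoint⇔rows S) disjoint
    back : ∀ S → Face (chessboard n r mult *ʲ joinPower (points r) k) (preimage β S) →
           Face (deletedJoin K) S
    back S ((cols , rowsˡ) , right-face) =
        (λ i → Equivalence.from (K-face i _) (subst (λ p → ∣ p ∣ ≤ mult i) (column-left i S) (cols i)))
      , Equivalence.from (disjoint⇔rows S)
          λ x → subst (λ z → ∣ row {v} {r} z S ∣ ≤ 1) (strictlyInverseˡ x) (rows-S (from x))
      where
      rows-S : ∀ z → ∣ row {v} {r} (to z) S ∣ ≤ 1
      rows-S (inj₁ x) = subst (λ p → ∣ p ∣ ≤ 1) (row-left x S) (rowsˡ x)
      rows-S (inj₂ y) = subst (λ p → ∣ p ∣ ≤ 1) (row-right y S)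
                          (Equivalence.to (joinPower-face k (right S)) right-face y)

-- This removes the trivial factor left when no point is movable; the sets `Fin (n + 0)` and `Fin n`
-- still have to be identified.
≅-emptyJoin : {K : Complex m} {L : Complex n} → K ≅ (L *ʲ emptyJoin) → K ≅ L
≅-emptyJoin {n = n} {K} {L} iso = record
  { vertices = ↔-trans vertices drop
  ; faces    = λ S → mk⇔
      (λ S∈K → subst (Face L) (pull S) (proj₁ (Equivalence.to (faces S) S∈K)))
      (λ S∈L → Equivalence.from (faces S) (subst (Face L) (sym (pull S)) S∈L , tt))
  }
  where
  open _≅_ iso
  drop : Fin (n + 0) ↔ Fin n
  drop = ↔-sym (mk↔ₛ′ (_↑ˡ 0) (λ x → [ (λ y → y) , (λ ()) ]′ (splitAt n x)) right-inverse left-inverse)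
    where
    left-inverse : ∀ x → [ (λ y → y) , (λ ()) ]′ (splitAt n {0} (x ↑ˡ 0)) ≡ x
    left-inverse x rewrite splitAt-↑ˡ n x 0 = refl
    right-inverse : ∀ x → [ (λ y → y) , (λ ()) ]′ (splitAt n {0} x) ↑ˡ 0 ≡ x
    right-inverse x with splitAt n {0} x in eq
    ... | inj₁ y = splitAt⁻¹-↑ˡ eq
  pull : ∀ S → preimage (_↑ˡ 0) (preimage (vertices ⟨$⟩ˡ_) S) ≡ preimage (↔-trans vertices drop ⟨$⟩ˡ_) S
  pull S = preimage-∘ (_↑ˡ 0) (vertices ⟨$⟩ˡ_) S

deletedJoin-cong : (K L : Fin r → Complex v) → (∀ i A → Face (K i) A ⇔ Face (L i) A) →
                   deletedJoin K ≅ deletedJoin L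
deletedJoin-cong K L K⇔L = record
  { vertices = ↔-refl
  ; faces    = λ S → subst (λ T → Face (deletedJoin K) S ⇔ Face (deletedJoin L) T) (sym (tabulate∘lookup S))
      (mk⇔ (λ (cols , disjoint) → (λ i → Equivalence.to (K⇔L i _) (cols i)) , disjoint)
           (λ (cols , disjoint) → (λ i → Equivalence.from (K⇔L i _) (cols i)) , disjoint))
  }

-- Alexander pairs

module _ {K : Fin 2 → Complex v} (alexander : IsAlexander K) where

  open IsAlexander alexander

  pair : Subset v → Subset v → Fin 2 → Subset v
  pair A B zero       = A
  pair A B (suc zero) = B

  -- If `B` and its complement were both faces, they would cover every point, although `large-gap`
  -- leaves one uncovered. Conversely, unavoidability for this disjoint pair forces one of them to
  -- be a face.
  second⇔dual : ∀ B → Face (K (suc zero)) B ⇔ (¬ Face (K zero) (∁ B))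
  second⇔dual B = mk⇔ to from
    where
    to : Face (K (suc zero)) B → ¬ Face (K zero) (∁ B)
    to B∈K₁ ∁B∈K₀
      with enumerate 1 _ (large-gap (pair (∁ B) B) (λ { zero → ∁B∈K₀ ; (suc zero) → B∈K₁ }))
    ... | ρ , _ , ρ∈ = x∈∁p⇒x∉p (ρ∈ zero) (p⊆⋃ (pair (∁ B) B) zero
      (x∉p⇒x∈∁p λ x∈B → x∈∁p⇒x∉p (ρ∈ zero) (p⊆⋃ (pair (∁ B) B) (suc zero) x∈B)))
    from : ¬ Face (K zero) (∁ B) → Face (K (suc zero)) B
    from ∁B∉K₀ with unavoidable (pair (∁ B) B) disjoint
      where
      disjoint : PairwiseDisjoint (pair (∁ B) B)
      disjoint zero       zero       0≢0 _        = 0≢0 refl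
      disjoint zero       (suc zero) _   (x , x∈) = let x∈∁B , x∈B = x∈p∩q⁻ _ B x∈ in x∈∁p⇒x∉p x∈∁B x∈B
      disjoint (suc zero) zero       _   (x , x∈) = let x∈B , x∈∁B = x∈p∩q⁻ B _ x∈ in x∈∁p⇒x∉p x∈∁B x∈B
      disjoint (suc zero) (suc zero) 1≢1 _        = 1≢1 refl
    ... | zero     , ∁B∈K₀ = contradiction ∁B∈K₀ ∁B∉K₀
    ... | suc zero , B∈K₁  = B∈K₁

  deletedJoin≅bierSphere : deletedJoin K ≅ bierSphere (K zero) (proper zero)
  deletedJoin≅bierSphere =
    deletedJoin-cong K (K zero Vector.∷ alexanderDual (K zero) (proper zero) Vector.∷ Vector.[])
      λ { zero A → mk⇔ (λ f → f) (λ f → f) ; (suc zero) B → second⇔dual B }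

-- Here `k` may be zero, so that the two outcomes for at least three members are treated together.
ChessboardJoin : (Fin r → Complex v) → Set
ChessboardJoin {r} K = Σ[ n ∈ ℕ ] Σ[ m ∈ (Fin r → ℕ) ] Σ[ k ∈ ℕ ]
  Optimal n r m × deletedJoin K ≅ (chessboard n r m *ʲ joinPower (points r) k)

module _ {v s : ℕ} (K : Fin (3 + s) → Complex v) (alexander : IsAlexander K) where

  open Exchange K alexander
  open Facet

  chessboard-join : ChessboardJoin K
  chessboard-join = from-facet (proj₂ facet-exists)
    where
    from-facet : ∀ {f₀} → Facet f₀ → ChessboardJoin K
    from-facet {f₀} F₀ = #in , mult ∘ suc , #out , optimal , deletedJoin-≅ bijection K (mult ∘ suc) K-face
      where
      open Classification F₀
      open Splitting (split Fixed?)
      size : ∀ A → ∣ preimage (Inverse.to bijection ∘ inj₁) A ∣ ≡ ∣ A ∩ V₀ ∣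
      size = ∣preimage∣ bijection (∈-toSubset⁺ Fixed? ∘ inside-P) (λ y → outside-P y ∘ ∈-toSubset⁻ Fixed?)
      K-face : ∀ i A → Face (K i) A ⇔ ∣ preimage (Inverse.to bijection ∘ inj₁) A ∣ ≤ mult (suc i)
      K-face i A = mk⇔ (λ A∈K → subst (_≤ mult (suc i)) (sym (size A)) (face⁻ i A A∈K))
                       (λ small → face⁺ i A (subst (_≤ mult (suc i)) (size A) small))
      n≡∣V₀∣ : #in ≡ ∣ V₀ ∣
      n≡∣V₀∣ = trans (sym (∣⊤∣≡n #in)) (trans (cong ∣_∣ (⊆-antisym all ⊆⊤))
                 (trans (size V₀) (cong ∣_∣ (∩-idem V₀))))
        where
        all : ⊤ ⊆ preimage (Inverse.to bijection ∘ inj₁) V₀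
        all {x} _ = ∈-preimage⁺ (Inverse.to bijection ∘ inj₁) (∈-toSubset⁺ Fixed? (inside-P x))
      mult-zero : mult zero ≡ 2 + s
      mult-zero = trans (cong ∣_∣ (⊆-antisym (p∩q⊆p _ V₀) λ x∈ →
        x∈p∩q⁺ (x∈ , ∈-toSubset⁺ Fixed? (zero-fixed reachable₀ (∈-fiber⁻ f₀ x∈))))) (tight F₀)
      -- The fixed points are counted by their label under `f₀`. All unlabelled points are fixed, so
      -- the label `zero` contributes exactly `2 + s`.
      optimal : Optimal #in (3 + s) (mult ∘ suc)
      optimal = begin
        #in                                    ≡⟨ n≡∣V₀∣ ⟩
        ∣ V₀ ∣                                 ≡⟨ sum-fibers f₀ V₀ ⟨
        mult zero + ∑.sum (mult ∘ suc)         ≡⟨ cong (_+ ∑.sum (mult ∘ suc)) mult-zero ⟩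
        2 + s + ∑.sum (mult ∘ suc)             ≡⟨ ℕ.+-comm (2 + s) _ ⟩
        ∑.sum (mult ∘ suc) + (2 + s)           ≡⟨ cong (_∸ 1) (ℕ.+-suc (∑.sum (mult ∘ suc)) (2 + s)) ⟨
        ∑.sum (mult ∘ suc) + (3 + s) ∸ 1       ∎
        where open ≡-Reasoning

corollary5p2 : (v r : ℕ) (K : Fin r → Complex v) → IsAlexander K →
    (r ≡ 2 × (Σ[ L ∈ Complex v ] Σ[ L-proper ∈ Proper L ] deletedJoin K ≅ bierSphere L L-proper))
    ⊎ (3 ≤ r × (Σ[ n ∈ ℕ ] Σ[ m ∈ (Fin r → ℕ) ]
    Optimal n r m × deletedJoin K ≅ chessboard n r m))
    ⊎ (3 ≤ r × (Σ[ n ∈ ℕ ] Σ[ m ∈ (Fin r → ℕ) ] Σ[ k ∈ ℕ ]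
    Optimal n r m × 1 ≤ k × deletedJoin K ≅ (chessboard n r m *ʲ joinPower (points r) k)))
-- Unavoidability of the empty tuple would produce an index in `Fin 0`.
corollary5p2 v 0 K alexander with IsAlexander.unavoidable alexander (λ ()) (λ ())
... | () , _
-- A single unavoidable complex contains every subset, so it is not proper.
corollary5p2 v 1 K alexander =
  Empty.⊥-elim (proj₂ (IsAlexander.proper alexander zero) λ {A} _ → all-faces A)
  where
  all-faces : ∀ A → Face (K zero) A
  all-faces A with IsAlexander.unavoidable alexander (λ _ → A) (λ { zero zero 0≢0 _ → 0≢0 refl })
  ... | zero , A∈K = A∈K
corollary5p2 v 2 K alexander =
  inj₁ (refl , K zero , IsAlexander.proper alexander zero , deletedJoin≅bierSphere alexander)
corollary5p2 v (suc (suc (suc s))) K alexander = conclude (chessboard-join K alexander)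
  where
  3≤r : 3 ≤ 3 + s
  3≤r = s≤s (s≤s (s≤s z≤n))
  conclude : ChessboardJoin K → _ ⊎ _
  conclude (n , m , zero  , optimal , iso) = inj₂ (inj₁ (3≤r , n , m , optimal , ≅-emptyJoin iso))
  conclude (n , m , suc k , optimal , iso) = inj₂ (inj₂ (3≤r , n , m , suc k , optimal , s≤s z≤n , iso))
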